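{- Let $G$ be an almost bipartite non-König-Egerváry graph with the unique odd cycle $C$. Then $\ker(G)=\mathrm{core}(G)$; moreover, if $G$ is connected, then $$\ker(G)=\bigcup_{y\in V(C)}\ker(D_y-y)=\bigcup_{y\in V(C)}\mathrm{core}(D_y-y)=\mathrm{core}(G).$$
   Context: All graphs are finite, undirected, without loops or multiple edges. $N(A)=\bigcup_{v\in A}N(v)$ denotes the (open) neighborhood of a vertex set $A$. $\alpha(G)$ is the maximum size of an independent set, $\mu(G)$ the maximum size of a matching, $n(G)=|V(G)|$. $G$ is a König-Egerváry graph if $\alpha(G)+\mu(G)=n(G)$, and non-König-Egerváry otherwise. A cycle is a closed trail whose only repeated vertices are the first and the last. $G$ is almost bipartite if it has a unique odd cycle, denoted $C$, with vertex set $V(C)$ and edge set $E(C)$. For $y\in V(C)$, $D_y$ is the connected component containing $y$ of the graph $G-E(C)$ (obtained by deleting the edges of $C$); it is bipartite. $D_y-y$ is the graph obtained from $D_y$ by deleting the vertex $y$ (possibly the graph with no vertices, for which $\ker$ and $\mathrm{core}$ are empty). $\mathrm{core}(G)$ is the intersection of all maximum independent sets of $G$. For $X\subseteq V(G)$, $d_G(X)=|X|-|N(X)|$, and $d(G)=\max\{d_G(X):X\subseteq V(G)\}$. A critical independent set of $G$ is an independent set $A$ with $d_G(A)=\max\{d_G(I): I \text{ independent in } G\}$ (this maximum is known to equal $d(G)$). $\ker(G)$ is the intersection of all critical independent sets of $G$ (the empty set is allowed as a critical independent set). -}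

module Defs where

open import Level using (0ℓ)
open import Data.Nat.Base using (ℕ; _+_; _≤_)
open import Data.Nat.Divisibility using (_∣_)
open import Data.Integer.Base as ℤ using (ℤ; _⊖_)
open import Data.Bool.Base using (true)
open import Data.Fin.Base using (Fin)
open import Data.Fin.Properties using (_≟_; any?)
open import Data.Fin.Subset using (Subset; _∈_; _⊆_; _∩_; _-_; ∣_∣)
open import Data.Fin.Subset.Properties using (_∈?_; x∈p∩q⁺)
open import Data.List.Base using (List; []; _∷_; _∷ʳ_; length; allFin)
import Data.List.Membership.Propositional as List
open import Data.List.Membership.Propositional.Properties using (∈-allFin)
import Data.List.Membership.DecPropositional as DecMembership
open import Data.List.Relation.Unary.All using (All)
open import Data.List.Relation.Unary.AllPairs using (AllPairs)
open import Data.List.Relation.Unary.Any using (here; there)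
open import Data.List.Relation.Unary.Linked using (Linked)
open import Data.List.Relation.Unary.Unique.Propositional using (Unique)
open import Data.Product.Base using (∃; ∃-syntax; _×_; _,_; swap)
open import Data.Product.Properties using (≡-dec)
open import Data.Sum.Base as Sum using (_⊎_; inj₁; inj₂)
open import Data.Vec.Base using (tabulate)
open import Data.Vec.Properties using (lookup∘tabulate; lookup⇒[]=; []=⇒lookup)
open import Function.Base using (_∘_)
open import Relation.Binary.Core using (Rel)
open import Relation.Binary.Definitions using (Symmetric; Decidable)
open import Relation.Binary.Construct.Closure.ReflexiveTransitive using (Star; ε; _◅_; _◅◅_)
open import Relation.Binary.PropositionalEquality using (_≡_; _≢_; refl; trans; sym)
open import Relation.Nullary using (¬_; Dec; yes; no; does; _×-dec_; _⊎-dec_; ¬?)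
open import Relation.Nullary.Decidable using (map′; dec-true)
open import Relation.Unary as Pred using (Pred; _≐_)

-- Subsets given by decidable predicates

module _ {n} {P : Pred (Fin n) 0ℓ} (P? : Pred.Decidable P) where

  comprehension : Subset n
  comprehension = tabulate (does ∘ P?)

  ∈-comprehension⁺ : ∀ {v} → P v → v ∈ comprehension
  ∈-comprehension⁺ {v} p =
    lookup⇒[]= v _ (trans (lookup∘tabulate (does ∘ P?) v) (dec-true (P? v) p))

  ∈-comprehension⁻ : ∀ {v} → v ∈ comprehension → P v
  ∈-comprehension⁻ {v} v∈ = witness (P? v)
    (trans (sym (lookup∘tabulate (does ∘ P?) v)) ([]=⇒lookup v∈))
    where
    witness : (d : Dec (P v)) → does d ≡ true → P v
    witness (yes p) _ = p

-- Reachability is decidable (Warshall's algorithm): `Via E ks u v` allows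
-- only inner vertices from ks.

module _ {n} (E : Rel (Fin n) 0ℓ) where

  Via : List (Fin n) → Rel (Fin n) 0ℓ
  Via []       u v = u ≡ v ⊎ E u v
  Via (k ∷ ks) u v = Via ks u v ⊎ (Via ks u k × Via ks k v)

  via-trans : ∀ ks {u w v} → w List.∈ ks → Via ks u w → Via ks w v → Via ks u v
  via-trans (k ∷ ks) (here refl) p q = inj₂ (into p , outof q)
    where
    into : ∀ {u} → Via (k ∷ ks) u k → Via ks u k
    into (inj₁ p)       = p
    into (inj₂ (p , _)) = p
    outof : ∀ {v} → Via (k ∷ ks) k v → Via ks k v
    outof (inj₁ q)       = q
    outof (inj₂ (_ , q)) = q
  via-trans (k ∷ ks) (there w∈) (inj₁ p) (inj₁ q) = inj₁ (via-trans ks w∈ p q)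
  via-trans (k ∷ ks) (there w∈) (inj₁ p) (inj₂ (q , r)) = inj₂ (via-trans ks w∈ p q , r)
  via-trans (k ∷ ks) (there w∈) (inj₂ (p , q)) (inj₁ r) = inj₂ (p , via-trans ks w∈ q r)
  via-trans (k ∷ ks) (there w∈) (inj₂ (p , _)) (inj₂ (_ , r)) = inj₂ (p , r)

  via⇒star : ∀ ks {u v} → Via ks u v → Star E u v
  via⇒star []       (inj₁ refl)    = ε
  via⇒star []       (inj₂ e)       = e ◅ ε
  via⇒star (k ∷ ks) (inj₁ p)       = via⇒star ks p
  via⇒star (k ∷ ks) (inj₂ (p , q)) = via⇒star ks p ◅◅ via⇒star ks q

  base⇒via : ∀ ks {u v} → u ≡ v ⊎ E u v → Via ks u v
  base⇒via []       p = p
  base⇒via (k ∷ ks) p = inj₁ (base⇒via ks p)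

  star⇒via : ∀ {u v} → Star E u v → Via (allFin n) u v
  star⇒via ε       = base⇒via (allFin n) (inj₁ refl)
  star⇒via (e ◅ p) =
    via-trans (allFin n) (∈-allFin _) (base⇒via (allFin n) (inj₂ e)) (star⇒via p)

  module _ (E? : Decidable E) where

    via? : ∀ ks → Decidable (Via ks)
    via? []       u v = (u ≟ v) ⊎-dec E? u v
    via? (k ∷ ks) u v = via? ks u v ⊎-dec (via? ks u k ×-dec via? ks k v)

    star? : Decidable (Star E)
    star? u v = map′ (via⇒star (allFin n)) star⇒via (via? (allFin n) u v)

-- Finite simple graphs. The vertex set is an arbitrary subset V of Fin n, so
-- that subgraphs live in the same ambient type and their vertex sets can be
-- compared and united directly.

record Graph (n : ℕ) : Set₁ where
  field
    V        : Subset n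
    E        : Rel (Fin n) 0ℓ
    E?       : Decidable E
    E-sym    : Symmetric E
    E-irrefl : ∀ {v} → ¬ E v v
    E⇒V      : ∀ {u v} → E u v → u ∈ V

open Graph public

module _ {n} (G : Graph n) where

  order : ℕ
  order = ∣ V G ∣

  induced : Subset n → Graph n
  induced S .V = V G ∩ S
  induced S .E u v = E G u v × u ∈ S × v ∈ S
  induced S .E? u v = E? G u v ×-dec (u ∈? S) ×-dec (v ∈? S)
  induced S .E-sym (e , u∈ , v∈) = E-sym G e , v∈ , u∈
  induced S .E-irrefl (e , _) = E-irrefl G e
  induced S .E⇒V (e , u∈ , _) = x∈p∩q⁺ (E⇒V G e , u∈)

  deleteVertex : Fin n → Graph n
  deleteVertex y = induced (V G - y)

  deleteEdges : {F : Rel (Fin n) 0ℓ} → Decidable F → Symmetric F → Graph n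
  deleteEdges F? F-sym .V = V G
  deleteEdges {F} F? F-sym .E u v = E G u v × ¬ F u v
  deleteEdges F? F-sym .E? u v = E? G u v ×-dec ¬? (F? u v)
  deleteEdges F? F-sym .E-sym (e , ¬f) = E-sym G e , ¬f ∘ F-sym
  deleteEdges F? F-sym .E-irrefl (e , _) = E-irrefl G e
  deleteEdges F? F-sym .E⇒V (e , _) = E⇒V G e

  component : Fin n → Graph n
  component y = induced (comprehension (star? (E G) (E? G) y))

  Connected : Set
  Connected = ∀ {u v} → u ∈ V G → v ∈ V G → Star (E G) u v

  N : Subset n → Subset n
  N A = comprehension λ w → any? λ v → (v ∈? A) ×-dec E? G v w

  Independent : Subset n → Set
  Independent S = S ⊆ V G × (∀ {u v} → u ∈ S → v ∈ S → ¬ E G u v)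

  MaximumIndependent : Subset n → Set
  MaximumIndependent S = Independent S × (∀ T → Independent T → ∣ T ∣ ≤ ∣ S ∣)

  core : Pred (Fin n) 0ℓ
  core v = ∀ S → MaximumIndependent S → v ∈ S

  d : Subset n → ℤ
  d X = ∣ X ∣ ⊖ ∣ N X ∣

  CriticalIndependent : Subset n → Set
  CriticalIndependent A = Independent A × (∀ I → Independent I → d I ℤ.≤ d A)

  ker : Pred (Fin n) 0ℓ
  ker v = ∀ A → CriticalIndependent A → v ∈ A

-- Matchings are lists of edges, each edge given by its two endpoints in either
-- order. Disjointness of the entries rules out repetitions, so the length of
-- the list is the size of the matching.

Disjoint : ∀ {n} → Rel (Fin n × Fin n) 0ℓ
Disjoint (a , b) (c , d) = (a ≢ c × a ≢ d) × (b ≢ c × b ≢ d)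

module _ {n} (G : Graph n) where

  Matching : List (Fin n × Fin n) → Set
  Matching M = All (λ (u , v) → E G u v) M × AllPairs Disjoint M

  MaximumMatching : List (Fin n × Fin n) → Set
  MaximumMatching M = Matching M × (∀ M′ → Matching M′ → length M′ ≤ length M)

  Isα : ℕ → Set
  Isα a = ∃[ S ] MaximumIndependent G S × ∣ S ∣ ≡ a

  Isμ : ℕ → Set
  Isμ m = ∃[ M ] MaximumMatching M × length M ≡ m

  KőnigEgerváry : Set
  KőnigEgerváry = ∃[ a ] ∃[ m ] Isα a × Isμ m × a + m ≡ order G

-- The directed steps of a walk given by its list of vertices.
steps : ∀ {A : Set} → List A → List (A × A)
steps []           = []
steps (x ∷ [])     = []
steps (x ∷ y ∷ xs) = (x , y) ∷ steps (y ∷ xs)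

SameEdge : ∀ {n} → Rel (Fin n × Fin n) 0ℓ
SameEdge e f = e ≡ f ⊎ e ≡ swap f

-- A cycle x₀, x₁, …, xₖ, x₀ has start x₀ and rest [x₁, …, xₖ]. The trail
-- condition excludes k = 1, that is, going back and forth along an edge.
record Cycle {n} (G : Graph n) : Set where
  field
    start : Fin n
    rest  : List (Fin n)

  vertices : List (Fin n)
  vertices = start ∷ rest

  walk : List (Fin n)
  walk = vertices ∷ʳ start

  field
    isWalk   : Linked (E G) walk
    isTrail  : AllPairs (λ e f → ¬ SameEdge e f) (steps walk)
    distinct : Unique vertices

  VC : Pred (Fin n) 0ℓ
  VC v = v List.∈ vertices

  EC : Rel (Fin n) 0ℓ
  EC u v = (u , v) List.∈ steps walk ⊎ (v , u) List.∈ steps walk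

  EC? : Decidable EC
  EC? u v = ((u , v) ∈ₑ? steps walk) ⊎-dec ((v , u) ∈ₑ? steps walk)
    where open DecMembership (≡-dec {B = λ _ → Fin n} _≟_ _≟_) renaming (_∈?_ to _∈ₑ?_)

  EC-sym : Symmetric EC
  EC-sym = Sum.swap

  OddCycle : Set
  OddCycle = ¬ 2 ∣ length vertices

open Cycle public using (VC; EC; EC?; EC-sym; OddCycle)

-- Cycles are compared as subgraphs: the starting point and the direction of
-- traversal are irrelevant.
SameCycle : ∀ {n} {G : Graph n} → Rel (Cycle G) 0ℓ
SameCycle C C′ = VC C ≐ VC C′ × (∀ u → EC C u ≐ EC C′ u)

record AlmostBipartite {n} (G : Graph n) : Set where
  field
    C        : Cycle G
    C-odd    : OddCycle C
    C-unique : ∀ C′ → OddCycle C′ → SameCycle C′ C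

-- D_y is `D G C y`, and D_y - y is `D- G C y`.
module _ {n} (G : Graph n) (C : Cycle G) where

  D : Fin n → Graph n
  D = component (deleteEdges G (EC? C) (EC-sym C))

  D- : Fin n → Graph n
  D- y = deleteVertex (D y) y

  -- ⋃ over y ∈ V(C) of F (D_y - y)
  ⋃D- : (Graph n → Pred (Fin n) 0ℓ) → Pred (Fin n) 0ℓ
  ⋃D- F = Pred.⋃ (∃ (VC C)) λ (y , _) → F (D- y)

module Submission where

-- Write matchings as involutions and call a vertex free if some maximum
-- matching misses it. If e is an edge of the odd cycle C, then G − e is
-- bipartite, since an odd closed walk contains an odd cycle. An end y of e that
-- were not free in G − e would lie outside an optimal independent set of G − e,
-- and G would be Kőnig–Egerváry. So the ends of e = yz are missed by maximum
-- matchings a and b of G − e. The component of y in a ∪ b contains z, otherwise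
-- exchanging a and b on it would give a matching to which e can be added. Then
-- a ∪ b ∪ e contains an odd closed walk, hence all of C, so a matches C − y
-- perfectly. It follows that G − C and, for each y on C, the path C − y can be
-- matched independently, that no free vertex of G − C is adjacent to C, and,
-- comparing independent sets with these matchings, that the free vertices of
-- G − C form both ker(G) and core(G). For the same reason (with no cycle) ker
-- and core of a bipartite graph are its free vertices, and a vertex is free in
-- G − C if and only if it is free in its branch D_y − y.
--
-- ker and core are stable under double negation, which makes the classical
-- parts of the argument (existence of maximum matchings, deciding freeness)
-- available.

open import Defs
import Algebra.Properties.CommutativeMonoid.Sum as Sum
open import Data.Bool.Base using (Bool; true; false; not; _xor_)
import Data.Bool.Properties as Bool
open import Data.Empty using (⊥; ⊥-elim)
open import Data.Fin.Base using (Fin; zero; suc)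
open import Data.Fin.Permutation using (permutation)
open import Data.Fin.Properties using (_≟_; any?; suc-injective)
open import Data.Fin.Subset using (Subset; ∣_∣; _∈_; _∉_; _-_; ⁅_⁆)
open import Data.Fin.Subset.Properties using (_∈?_; x∈p∧x≢y⇒x∈p-y; x∈p⇒∣p-x∣<∣p∣; x∈p∩q⁺; x∈p∩q⁻; p─q─q≡p─q)
open import Data.Integer.Base as ℤ using (ℤ; _⊖_)
import Data.Integer.Properties as ℤ
open import Data.List.Base using (List; []; _∷_; _∷ʳ_; length; allFin; filter; map)
import Data.List.Membership.DecPropositional as DecMembership
import Data.List.Membership.Propositional as List
open import Data.List.Membership.Propositional.Properties using (∈-allFin; ∈-filter⁺; ∈-++⁻)
open import Data.List.Properties using (filter-≐; length-map)
open import Data.List.Relation.Unary.All as All using (All; []; _∷_)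
open import Data.List.Relation.Unary.All.Properties using (∷ʳ⁺; all-filter)
import Data.List.Relation.Unary.All.Properties as All
open import Data.List.Relation.Unary.AllPairs as AllPairs using (AllPairs; []; _∷_)
import Data.List.Relation.Unary.AllPairs.Properties as AllPairs
open import Data.List.Relation.Unary.Any using (here; there)
open import Data.List.Relation.Unary.Linked as Linked using (Linked; []; [-]; _∷_)
open import Data.List.Relation.Unary.Unique.Propositional using (Unique)
import Data.List.Relation.Unary.Unique.Propositional.Properties as Unique
open import Data.Nat.Base using (ℕ; zero; suc; _+_; _*_; _<_; _≤_; z≤n; s≤s; z<s; s<s; _%_; _/_)
open import Data.Nat.DivMod using (m≡m%n+[m/n]*n; m%n<n; m<n⇒m%n≡m; [m+n]%n≡m%n; n%n≡0; m%n%n≡m%n; %-distribˡ-+; [m+kn]%n≡m%n)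
open import Data.Nat.Divisibility using (_∣_; divides; ∣⇒≤; ∣m+n∣m⇒∣n; n∣m*n)
open import Data.Nat.Induction using (<-wellFounded)
open import Data.Nat.Properties as ℕ using (+-suc; +-comm; +-assoc; +-identityʳ; +-0-commutativeMonoid; +-mono-≤; ≤-refl; ≤-trans; ≤-reflexive)
open import Data.Product.Base using (∃; ∃-syntax; Σ-syntax; _×_; _,_; proj₁; proj₂)
open import Data.Product.Properties using (≡-dec)
open import Data.Sum.Base using (_⊎_; inj₁; inj₂; [_,_]′)
open import Data.Vec.Base as Vec using ([]; _∷_)
open import Function.Base using (_∘_; id)
open import Induction.WellFounded using (Acc; acc)
open import Level using (0ℓ)
open import Relation.Binary.Construct.Closure.ReflexiveTransitive using (Star; ε; _◅_; _◅◅_; reverse)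
open import Relation.Binary.Core using (Rel)
open import Relation.Binary.Definitions using (Symmetric; Decidable)
open import Relation.Binary.PropositionalEquality using (_≡_; _≢_; refl; trans; sym; cong; subst; module ≡-Reasoning; cong₂; subst₂)
open import Relation.Nullary using (¬_; Dec; yes; no; does; _×-dec_; contradiction; _⊎-dec_; ¬?)
open import Relation.Nullary.Decidable using (map′; ¬¬-excluded-middle; decidable-stable)
open import Relation.Nullary.Negation using (¬¬-map)
open import Relation.Unary as Pred using (Pred; _≐_)

-- Parity of numbers and proper two-colourings

odd : ℕ → Bool
odd zero    = false
odd (suc n) = not (odd n)

odd-even : ∀ q → odd (q * 2) ≡ false
odd-even zero    = refl
odd-even (suc q) = trans (Bool.not-involutive _) (odd-even q)

odd⇒2∤ : ∀ {m} → odd m ≡ true → ¬ 2 ∣ m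
odd⇒2∤ o (divides q refl) = contradiction (trans (sym o) (odd-even q)) λ ()

even⇒2∣ : ∀ m → odd m ≡ false → 2 ∣ m
even⇒2∣ zero          _ = divides 0 refl
even⇒2∣ (suc (suc m)) o with even⇒2∣ m (trans (sym (Bool.not-involutive _)) o)
... | divides q refl = divides (suc q) refl

2∤⇒odd : ∀ m → ¬ 2 ∣ m → odd m ≡ true
2∤⇒odd m 2∤m with odd m in eq
... | true  = refl
... | false = contradiction (even⇒2∣ m eq) 2∤m

does-≡ : ∀ {P Q : Set} (p? : Dec P) (q? : Dec Q) → does p? ≡ does q? → (P × Q) ⊎ (¬ P × ¬ Q)
does-≡ (yes p) (yes q) _ = inj₁ (p , q)
does-≡ (no ¬p) (no ¬q) _ = inj₂ (¬p , ¬q)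

Colouring : ∀ {n} → Rel (Fin n) 0ℓ → (Fin n → Bool) → Set
Colouring R c = ∀ {u v} → R u v → c u ≢ c v

xor-cancelʳ : ∀ {a b} x → a xor x ≡ b xor x → a ≡ b
xor-cancelʳ {true}  {true}  x _ = refl
xor-cancelʳ {true}  {false} x eq = contradiction (sym eq) (Bool.not-¬ refl)
xor-cancelʳ {false} {true}  x eq = contradiction eq (Bool.not-¬ refl)
xor-cancelʳ {false} {false} x _ = refl

-- A nontrivial step flips both colours, which leaves their exclusive or unchanged. This compares
-- two colourings at the ends of a walk that is properly coloured by both.
xor-invariant : ∀ {n} {T : Rel (Fin n) 0ℓ} {c c′ : Fin n → Bool} →
                (∀ {u v} → T u v → u ≡ v ⊎ (c u ≢ c v × c′ u ≢ c′ v)) →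
                ∀ {u v} → Star T u v → c u xor c′ u ≡ c v xor c′ v
xor-invariant step ε = refl
xor-invariant {c = c} {c′} step {u} (_◅_ {j = w} t s) = trans (one (step t)) (xor-invariant {c = c} {c′} step s)
  where
  one : u ≡ w ⊎ (c u ≢ c w × c′ u ≢ c′ w) → c u xor c′ u ≡ c w xor c′ w
  one (inj₁ refl) = refl
  one (inj₂ (≢ , ≢′)) = trans (cong₂ _xor_ (Bool.¬-not ≢) (Bool.¬-not ≢′)) (Bool.xor-annihilates-not (c w) (c′ w))

-- Trails

steps-all : ∀ {A : Set} {P : A → Set} {xs} → All P xs →
            All (λ (c , d) → P c × P d) (steps xs)
steps-all []            = []
steps-all (p ∷ [])      = []
steps-all (p ∷ q ∷ ps) = (p , q) ∷ steps-all (q ∷ ps)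

steps-init : ∀ {A : Set} {P : A → Set} {x xs} → All P xs →
             All (λ (c , d) → P c) (steps (xs ∷ʳ x))
steps-init []           = []
steps-init (p ∷ [])     = p ∷ []
steps-init (p ∷ q ∷ ps) = p ∷ steps-init (q ∷ ps)

unique-∷ʳ : ∀ {A : Set} {x : A} {xs} → All (x ≢_) xs → Unique xs → Unique (xs ∷ʳ x)
unique-∷ʳ []          []       = [] ∷ []
unique-∷ʳ (x≢y ∷ x≢ys) (y≢ ∷ u) = ∷ʳ⁺ y≢ (x≢y ∘ sym) ∷ unique-∷ʳ x≢ys u

path-trail : ∀ {n} {xs : List (Fin n)} → Unique xs →
             AllPairs (λ e f → ¬ SameEdge e f) (steps xs)
path-trail []                    = []
path-trail (_ ∷ [])              = []
path-trail (x∉@(_ ∷ _) ∷ u@(_ ∷ _)) =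
  All.map (λ { (≢c , ≢d) (inj₁ refl) → ≢c refl ; (≢c , ≢d) (inj₂ refl) → ≢d refl })
          (steps-all x∉)
  ∷ path-trail u

-- A third vertex keeps the closing step from retracing the first edge. After the second step, every
-- step starts at a vertex other than `x` and `y`, so the first edge never recurs.
closed-trail : ∀ {n} {x y z : Fin n} {zs} → Unique (x ∷ y ∷ z ∷ zs) →
               AllPairs (λ e f → ¬ SameEdge e f) (steps ((x ∷ y ∷ z ∷ zs) ∷ʳ x))
closed-trail (x∉@(_ ∷ x∉zs@(x≢z ∷ _)) ∷ u@(y∉ ∷ _)) =
  ((λ { (inj₁ refl) → All.head x∉ refl ; (inj₂ refl) → x≢z refl }) ∷
   All.map (λ { (≢x , ≢y) (inj₁ refl) → ≢x refl ; (≢x , ≢y) (inj₂ refl) → ≢y refl })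
           (steps-init (All.zip (x∉zs , y∉))))
  ∷ path-trail (unique-∷ʳ x∉ u)

-- Parity of walks

module _ {n} (R : Rel (Fin n) 0ℓ) where

  data Walk : Bool → Rel (Fin n) 0ℓ where
    []  : ∀ {u} → Walk false u u
    _∷_ : ∀ {b u w v} → R u w → Walk b w v → Walk (not b) u v

  -- The list contains the vertices of the path except the last one.
  data Path : Fin n → List (Fin n) → Fin n → Set where
    []  : ∀ {u} → Path u [] u
    _∷_ : ∀ {u w v xs} → R u w → Path w xs v → Path u (u ∷ xs) v

module _ {n} {R : Rel (Fin n) 0ℓ} where

  star⇒walk : ∀ {u v} → Star R u v → ∃[ b ] Walk R b u v
  star⇒walk ε       = false , []
  star⇒walk (e ◅ p) = _ , e ∷ proj₂ (star⇒walk p)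

  reverse-append : Symmetric R → ∀ {b b′ u v w} → Walk R b u v → Walk R b′ u w →
                   Walk R (b xor b′) v w
  reverse-append R-sym []                q = q
  reverse-append R-sym {b′ = b′} (_∷_ {b} e p) q =
    subst (λ a → Walk R a _ _) (trans (sym (Bool.not-distribʳ-xor b b′)) (Bool.not-distribˡ-xor b b′))
          (reverse-append R-sym p (R-sym e ∷ q))

  path⇒linked : ∀ {u xs v} → Path R u xs v → Linked R (xs ∷ʳ v)
  path⇒linked []            = [-]
  path⇒linked (e ∷ [])      = e ∷ [-]
  path⇒linked (e ∷ (f ∷ p)) = e ∷ path⇒linked (f ∷ p)

  path⇒steps : ∀ {u xs v} → Path R u xs v → All (λ (c , d) → R c d) (steps (xs ∷ʳ v))
  path⇒steps []            = []
  path⇒steps (e ∷ [])      = e ∷ []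
  path⇒steps (e ∷ (f ∷ p)) = e ∷ path⇒steps (f ∷ p)

  -- A path from `w` to `v` cut at a visit of `u`. The field `fresh` lets the induction put further
  -- vertices in front of `before` without losing distinctness.
  record Split (u w : Fin n) (xs : List (Fin n)) (v : Fin n) : Set where
    field
      {before after} : List (Fin n)
      path-before    : Path R w before u
      path-after     : Path R u after v
      unique-before  : Unique (u ∷ before)
      unique-after   : Unique (after ∷ʳ v)
      fresh          : ∀ {x} → All (x ≢_) (xs ∷ʳ v) → All (x ≢_) before
      parity         : odd (length xs) ≡ odd (length before) xor odd (length after)

  split : ∀ u {w xs v} → Path R w xs v → Unique (xs ∷ʳ v) →
          All (u ≢_) (xs ∷ʳ v) ⊎ Split u w xs v
  split u {w} p U with w ≟ u
  split u {w} p U | yes refl = inj₂ record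
    { path-before = [] ; path-after = p ; unique-before = [] ∷ [] ; unique-after = U
    ; fresh = λ _ → [] ; parity = refl }
  split u {w} [] U | no w≢u = inj₁ ((w≢u ∘ sym) ∷ [])
  split u {w} (e ∷ p) (w∉ ∷ U) | no w≢u with split u p U
  ... | inj₁ u∉ = inj₁ ((w≢u ∘ sym) ∷ u∉)
  ... | inj₂ s with Split.unique-before s
  ... | u∉ ∷ Ub = inj₂ record
    { path-before = e ∷ S.path-before
    ; path-after = S.path-after
    ; unique-before = ((w≢u ∘ sym) ∷ u∉) ∷ S.fresh w∉ ∷ Ub
    ; unique-after = S.unique-after
    ; fresh = λ { (x≢ ∷ x∉) → x≢ ∷ S.fresh x∉ }
    ; parity = trans (cong not S.parity) (Bool.not-distribˡ-xor (odd (length S.before)) _) }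
    where
    module S = Split s

module _ {n} (G : Graph n) {R : Rel (Fin n) 0ℓ} (R-sym : Symmetric R)
         (R⊆E : ∀ {u v} → R u v → E G u v) where

  OddCycleWithin : Set
  OddCycleWithin = Σ[ C ∈ Cycle G ] OddCycle C × (∀ {u v} → EC C u v → R u v)

  -- Length one would be a loop and length two is even, so at least three distinct vertices remain
  -- and the walk is a trail.
  closedPath⇒cycle : ∀ {u ys} → Path R u (u ∷ ys) u → Unique (u ∷ ys) →
                     odd (suc (length ys)) ≡ true → OddCycleWithin
  closedPath⇒cycle {u} {[]}         (e ∷ []) U o = contradiction (R⊆E e) (E-irrefl G)
  closedPath⇒cycle {u} {_ ∷ []}     p        U ()
  closedPath⇒cycle {u} {y ∷ z ∷ ys} p        U o =
    record { start = u ; rest = y ∷ z ∷ ys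
           ; isWalk = Linked.map R⊆E (path⇒linked p)
           ; isTrail = closed-trail U ; distinct = U }
    , odd⇒2∤ o
    , [ All.lookup (path⇒steps p) , R-sym ∘ All.lookup (path⇒steps p) ]′

  -- If the new first vertex already occurs on the path, the closed part is either an odd cycle or
  -- even, and cutting out an even part preserves parity.
  erase-loops : ∀ {b u v} → Walk R b u v →
                OddCycleWithin ⊎ ∃[ xs ] Path R u xs v × Unique (xs ∷ʳ v) × odd (length xs) ≡ b
  erase-loops []      = inj₂ ([] , [] , [] ∷ [] , refl)
  erase-loops {u = u} (_∷_ {b} e p) with erase-loops p
  ... | inj₁ C = inj₁ C
  ... | inj₂ (xs , q , U , refl) with split u q U
  ... | inj₁ u∉ = inj₂ (u ∷ xs , e ∷ q , u∉ ∷ U , refl)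
  ... | inj₂ s with odd (length (Split.before s)) in eq
  ... | false = inj₁ (closedPath⇒cycle (e ∷ Split.path-before s) (Split.unique-before s) (cong not eq))
  ... | true = inj₂ (after , path-after , unique-after , (begin
          odd (length after)                            ≡⟨ Bool.not-involutive _ ⟨
          not (not (odd (length after)))                ≡⟨ cong (λ b → not (b xor odd (length after))) eq ⟨
          not (odd (length before) xor odd (length after)) ≡⟨ cong not parity ⟨
          not (odd (length xs))                         ∎))
    where open Split s
          open ≡-Reasoning

  -- A path with distinct vertices from `u` back to `u` has length zero, which is even; so loop
  -- erasure must have met an odd cycle.
  oddClosedWalk⇒cycle : ∀ {u} → Walk R true u u → OddCycleWithin
  oddClosedWalk⇒cycle w with erase-loops w
  ... | inj₁ C = C
  ... | inj₂ (_ ∷ xs , (_ ∷ _) , (u∉ ∷ _) , _) = ⊥-elim (last≢ u∉ refl)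
    where
    last≢ : ∀ {A : Set} {x y : A} {xs} → All (x ≢_) (xs ∷ʳ y) → x ≢ y
    last≢ {xs = []}    (p ∷ _) = p
    last≢ {xs = _ ∷ _} (_ ∷ p) = last≢ p

-- Two-colouring subgraphs without odd cycles

module _ {n} {R : Rel (Fin n) 0ℓ} (R? : Decidable R) where

  private
    R² : Rel (Fin n) 0ℓ
    R² u v = ∃[ w ] R u w × R w v

    R²? : Decidable R²
    R²? u v = any? λ w → R? u w ×-dec R? w v

    Reach² : Bool → Rel (Fin n) 0ℓ
    Reach² false u v = Star R² u v
    Reach² true  u v = ∃[ w ] R u w × Star R² w v

    walk⇒reach² : ∀ {b u v} → Walk R b u v → Reach² b u v
    walk⇒reach² []                     = ε
    walk⇒reach² (_∷_ {b = false} e p) = _ , e , walk⇒reach² p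
    walk⇒reach² (_∷_ {b = true} e p) with walk⇒reach² p
    ... | _ , f , q = (_ , e , f) ◅ q

    reach²⇒walk : ∀ {u v} → Star R² u v → Walk R false u v
    reach²⇒walk ε                 = []
    reach²⇒walk ((_ , e , f) ◅ p) = e ∷ (f ∷ reach²⇒walk p)

  -- Even walks are the walks of the relation "two steps of `R`", for which reachability is
  -- decidable.
  evenWalk? : Decidable (Walk R false)
  evenWalk? u v = map′ reach²⇒walk walk⇒reach² (star? R² R²? u v)

module _ {n} {G : Graph n} (ab : AlmostBipartite G) where

  open AlmostBipartite ab

  -- An odd cycle of G within R would have the same edges as C; so R is
  -- coloured by the parity of the distance to a representative of the component.
  two-colouring : {R : Rel (Fin n) 0ℓ} → Decidable R → Symmetric R →
                  (∀ {u v} → R u v → E G u v) →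
                  ¬ (∀ {u v} → EC C u v → R u v) → ∃[ c ] Colouring R c
  two-colouring {R} R? R-sym R⊆E EC⊈R = c , proper
    where
    reachable : Fin n → List (Fin n)
    reachable v = filter (star? R R? v) (allFin n)

    colour : List (Fin n) → Fin n → Bool
    -- The list passed is `reachable v`, which contains `v`, so this value is never relevant.
    colour []      v = false
    colour (r ∷ _) v = does (evenWalk? R? r v)

    c : Fin n → Bool
    c v = colour (reachable v) v

    ¬odd : ∀ {u} → ¬ Walk R true u u
    ¬odd w with oddClosedWalk⇒cycle G R-sym R⊆E w
    ... | C′ , o , ⊆R = EC⊈R (λ {u} e → ⊆R (proj₂ (proj₂ (C-unique C′ o) u) e))

    colour-proper : ∀ {u v} xs → u List.∈ xs → All (Star R u) xs → R u v → colour xs u ≢ colour xs v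
    colour-proper {u} {v} (r ∷ _) _ (u~r ∷ _) e eq
      with does-≡ (evenWalk? R? r u) (evenWalk? R? r v) eq
    ... | inj₁ (p , q)   = ¬odd (R-sym e ∷ reverse-append R-sym p q)
    ... | inj₂ (¬p , ¬q) = odd-odd (star⇒walk (reverse R-sym u~r))
                                   (star⇒walk (reverse R-sym u~r ◅◅ e ◅ ε))
      where
      odd-odd : ∃[ b ] Walk R b r u → ∃[ b ] Walk R b r v → ⊥
      odd-odd (false , p) _           = ¬p p
      odd-odd (true , p)  (false , q) = ¬q q
      odd-odd (true , p)  (true , q)  = ¬odd (R-sym e ∷ reverse-append R-sym p q)

    proper : Colouring R c
    proper {u} {v} e eq = colour-proper (reachable u) (∈-filter⁺ (star? R R? u) (∈-allFin u) ε)
      (all-filter (star? R R? u) (allFin n)) e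
      -- Adjacent vertices reach the same vertices, hence have equal filtered lists and the same
      -- representative.
      (trans eq (cong (λ xs → colour xs v)
        (filter-≐ (star? R R? v) (star? R R? u) ((e ◅_) , (R-sym e ◅_)) (allFin n))))

-- A cycle as a periodic sequence

module _ {A : Set} where

  nth : A → List A → ℕ → A
  nth d []       _       = d
  nth d (x ∷ xs) zero    = x
  nth d (x ∷ xs) (suc i) = nth d xs i

  nth-∈ : ∀ {d} xs {i} → i < length xs → nth d xs i List.∈ xs
  nth-∈ (x ∷ xs) {zero}  _       = here refl
  nth-∈ (x ∷ xs) {suc i} (s≤s l) = there (nth-∈ xs l)

  nth-length : ∀ {d} xs → nth d xs (length xs) ≡ d
  nth-length []       = refl
  nth-length (_ ∷ xs) = nth-length xs

  ∈⇒nth : ∀ {d xs v} → v List.∈ xs → ∃[ i ] i < length xs × nth d xs i ≡ v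
  ∈⇒nth (here refl) = 0 , z<s , refl
  ∈⇒nth (there v∈) with ∈⇒nth v∈
  ... | i , l , eq = suc i , s<s l , eq

  nth-injective : ∀ {d xs i j} → Unique xs → i < length xs → j < length xs →
                  nth d xs i ≡ nth d xs j → i ≡ j
  nth-injective {i = zero}  {zero}  _ _ _ _ = refl
  nth-injective {xs = _ ∷ xs} {zero}  {suc j} (x∉ ∷ _) _ (s≤s l) eq =
    contradiction eq (All.lookup x∉ (nth-∈ xs l))
  nth-injective {xs = _ ∷ xs} {suc i} {zero}  (x∉ ∷ _) (s≤s l) _ eq =
    contradiction (sym eq) (All.lookup x∉ (nth-∈ xs l))
  nth-injective {xs = _ ∷ _} {suc i} {suc j} (_ ∷ U) (s≤s k) (s≤s l) eq =
    cong suc (nth-injective U k l eq)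

  -- At the last index the default value `d` serves as the second end, which is the closing step of
  -- the walk.
  nth-step : ∀ {d} xs {i} → i < length xs →
             (nth d xs i , nth d xs (suc i)) List.∈ steps (xs ∷ʳ d)
  nth-step (x ∷ [])     {zero}  _       = here refl
  nth-step (x ∷ y ∷ xs) {zero}  _       = here refl
  nth-step (x ∷ y ∷ xs) {suc i} (s≤s l) = there (nth-step (y ∷ xs) l)
  nth-step (x ∷ [])     {suc i} (s≤s ())

-- Equal residues make the modulus divide `d`, and `d` is smaller than the modulus.
shift-≡0 : ∀ {L} i {d} → d < suc L → i % suc L ≡ (i + d) % suc L → d ≡ 0
shift-≡0         i {zero}  _   _  = refl
shift-≡0 {L} i {suc d} d<L eq = contradiction (∣⇒≤ L∣d) (ℕ.<⇒≱ d<L)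
  where
  M = suc L
  r = (i + suc d) % M
  lemma : r + ((i / M) * M + suc d) ≡ r + (i + suc d) / M * M
  lemma = begin
    r + ((i / M) * M + suc d)      ≡⟨ +-assoc r _ _ ⟨
    (r + (i / M) * M) + suc d      ≡⟨ cong (λ s → s + (i / M) * M + suc d) eq ⟨
    (i % M + (i / M) * M) + suc d  ≡⟨ cong (_+ suc d) (m≡m%n+[m/n]*n i M) ⟨
    i + suc d                      ≡⟨ m≡m%n+[m/n]*n (i + suc d) M ⟩
    r + (i + suc d) / M * M        ∎
    where open ≡-Reasoning
  L∣d : M ∣ suc d
  L∣d = ∣m+n∣m⇒∣n (divides ((i + suc d) / M) (ℕ.+-cancelˡ-≡ r _ _ lemma)) (n∣m*n (i / M))

module CyclicOrder {n} {G : Graph n} (C : Cycle G) where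

  open Cycle C using (start; rest; vertices; walk; isWalk; distinct)

  L : ℕ
  L = length vertices

  abstract

    -- The vertices of C as an L-periodic sequence; `nth start vertices L` is the
    -- default value start, as it should be.
    p : ℕ → Fin n
    p i = nth start vertices (i % L)

    p-period : ∀ i → p (i + L) ≡ p i
    p-period i = cong (nth start vertices) ([m+n]%n≡m%n i L)

    p∈VC : ∀ i → VC C (p i)
    p∈VC i = nth-∈ vertices (m%n<n i L)

    VC⇒p : ∀ {v} → VC C v → ∃[ i ] p i ≡ v
    VC⇒p v∈ with ∈⇒nth {d = start} v∈
    ... | i , l , eq = i , trans (cong (nth start vertices) (m<n⇒m%n≡m l)) eq

    p-injective : ∀ i {d} → d < L → p i ≡ p (i + d) → d ≡ 0
    p-injective i d<L eq =
      shift-≡0 i d<L (nth-injective distinct (m%n<n i L) (m%n<n (i + _) L) eq)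

    private
      suc-% : ∀ i → suc i % L ≡ suc (i % L) % L
      suc-% i = begin
        suc i % L                ≡⟨ %-distribˡ-+ 1 i L ⟩
        (1 % L + i % L) % L      ≡⟨ cong (λ r → (1 % L + r) % L) (m%n%n≡m%n i L) ⟨
        (1 % L + i % L % L) % L  ≡⟨ %-distribˡ-+ 1 (i % L) L ⟨
        suc (i % L) % L          ∎
        where open ≡-Reasoning

      p-suc : ∀ i → p (suc i) ≡ nth start vertices (suc (i % L))
      p-suc i with ℕ.m≤n⇒m<n∨m≡n (m%n<n i L)
      ... | inj₁ l  = cong (nth start vertices) (trans (suc-% i) (m<n⇒m%n≡m l))
      ... | inj₂ eq = begin
        p (suc i)                         ≡⟨ cong (nth start vertices) (suc-% i) ⟩
        nth start vertices (suc (i % L) % L)  ≡⟨ cong (λ j → nth start vertices (j % L)) eq ⟩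
        nth start vertices (L % L)        ≡⟨ cong (nth start vertices) (n%n≡0 L) ⟩
        start                             ≡⟨ nth-length vertices ⟨
        nth start vertices L              ≡⟨ cong (nth start vertices) eq ⟨
        nth start vertices (suc (i % L))  ∎
        where open ≡-Reasoning

    p-EC : ∀ i → EC C (p i) (p (suc i))
    p-EC i = inj₁ (subst (λ v → (p i , v) List.∈ steps walk) (sym (p-suc i))
                         (nth-step vertices (m%n<n i L)))

    VC⇒p-from : ∀ i {v} → VC C v → ∃[ t ] t < L × p (i + t) ≡ v
    VC⇒p-from i v∈C with VC⇒p v∈C
    ... | j , refl = s % L , m%n<n s L , cong (nth start vertices) lemma
      where
      s : ℕ
      -- As `L` is one more than `length rest`, the summand acts as minus `i` modulo `L`, and
      -- `i + s` is congruent to `j`.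
      s = j + i * length rest
      lemma : (i + s % L) % L ≡ j % L
      lemma = begin
        (i + s % L) % L          ≡⟨ %-distribˡ-+ i (s % L) L ⟩
        (i % L + s % L % L) % L  ≡⟨ cong (λ r → (i % L + r) % L) (m%n%n≡m%n s L) ⟩
        (i % L + s % L) % L      ≡⟨ %-distribˡ-+ i s L ⟨
        (i + s) % L              ≡⟨ cong (_% L) rearrange ⟩
        (j + i * L) % L          ≡⟨ [m+kn]%n≡m%n j i L ⟩
        j % L                    ∎
        where
        open ≡-Reasoning
        rearrange : i + s ≡ j + i * L
        rearrange = begin
          i + (j + i * length rest)  ≡⟨ +-assoc i j _ ⟨
          i + j + i * length rest    ≡⟨ cong (_+ i * length rest) (+-comm i j) ⟩
          j + i + i * length rest    ≡⟨ +-assoc j i _ ⟩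
          j + (i + i * length rest)  ≡⟨ cong (j +_) (ℕ.*-suc i (length rest)) ⟨
          j + i * L                  ∎

  EC⇒E : ∀ {u v} → EC C u v → E G u v
  EC⇒E = [ step⇒E isWalk , E-sym G ∘ step⇒E isWalk ]′
    where
    step⇒E : ∀ {xs u v} → Linked (E G) xs → (u , v) List.∈ steps xs → E G u v
    step⇒E (e ∷ l) (here refl) = e
    step⇒E (e ∷ l) (there ∈s)  = step⇒E l ∈s

  EC⇒VC : ∀ {u v} → EC C u v → VC C u
  EC⇒VC = [ walk⇒vertices ∘ proj₁ ∘ All.lookup (steps-all self)
          , walk⇒vertices ∘ proj₂ ∘ All.lookup (steps-all self) ]′
    where
    self : All (List._∈ walk) walk
    self = All.tabulate (λ x∈ → x∈)
    walk⇒vertices : ∀ {v} → v List.∈ walk → VC C v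
    walk⇒vertices v∈ with ∈-++⁻ vertices v∈
    ... | inj₁ v∈xs       = v∈xs
    ... | inj₂ (here refl) = here refl

  VC⇒V : ∀ {v} → VC C v → v ∈ V G
  VC⇒V v∈C with VC⇒p v∈C
  ... | i , refl = E⇒V G (EC⇒E (p-EC i))

  module _ (C-odd : OddCycle C) where

    L-odd : odd L ≡ true
    L-odd = 2∤⇒odd L C-odd

    2<L : 2 < L
    2<L = odd⇒2< L L-odd λ L≡1 → contradiction (EC⇒E (p-EC 0))
        (subst (λ v → ¬ E G (p 0) v) (trans (sym (p-period 0)) (cong p L≡1)) (E-irrefl G))
      where
      odd⇒2< : ∀ l → odd l ≡ true → l ≢ 1 → 2 < l
      odd⇒2< 1                   _ l≢1 = contradiction refl l≢1
      odd⇒2< (suc (suc (suc _))) _ _   = s≤s (s≤s (s≤s z≤n))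

    p-≢ : ∀ i {d} → 0 < d → d < L → p i ≢ p (i + d)
    p-≢ i {suc d} _ d<L eq = contradiction (p-injective i d<L eq) λ ()

    -- Equal orientation contradicts injectivity at the first ends. For opposite orientation the
    -- second end fails when `d` is 1, because `L` exceeds 2, and the first end fails when `d` is
    -- larger.
    p-edges-distinct : ∀ i {d} → 0 < d → d < L →
      ¬ SameEdge (p (i + d) , p (suc (i + d))) (p i , p (suc i))
    p-edges-distinct i 0<d d<L (inj₁ eq) = p-≢ i 0<d d<L (sym (cong proj₁ eq))
    p-edges-distinct i {suc zero} 0<d d<L (inj₂ eq) = p-≢ i {2} z<s 2<L
      (trans (sym (cong proj₂ eq)) (cong p (sym (+-suc i 1))))
    p-edges-distinct i {suc (suc d)} 0<d d<L (inj₂ eq) =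
      p-≢ (suc i) {suc d} z<s (ℕ.<-trans (ℕ.n<1+n _) d<L)
        (trans (sym (cong proj₁ eq)) (cong p (+-suc i (suc d))))

module _ {n} {G : Graph n} (C : Cycle G) where

  vc? : Pred.Decidable (VC C)
  vc? v = v ∈ₗ? Cycle.vertices C
    where open DecMembership _≟_ renaming (_∈?_ to _∈ₗ?_)

-- Cutting an edge of the odd cycle

module Cut {n} {G : Graph n} (ab : AlmostBipartite G) where

  open AlmostBipartite ab
  open CyclicOrder C

  module _ (i : ℕ) where

    cut : Graph n
    cut = deleteEdges G {λ u v → SameEdge (u , v) (p i , p (suc i))}
      (λ u v → ≡-dec _≟_ _≟_ (u , v) (p i , p (suc i)) ⊎-dec ≡-dec _≟_ _≟_ (u , v) (p (suc i) , p i))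
      λ { (inj₁ refl) → inj₂ refl ; (inj₂ refl) → inj₁ refl }

    ¬EC⇒cut : ∀ {u v} → E G u v → ¬ EC C u v → E cut u v
    ¬EC⇒cut e ¬ec = e , λ { (inj₁ refl) → ¬ec (p-EC i) ; (inj₂ refl) → ¬ec (EC-sym C (p-EC i)) }

    private
      -- The deleted edge lies on `C`, so no odd cycle survives.
      colouring : ∃[ c ] Colouring (E cut) c
      colouring = two-colouring ab (E? cut) (λ {u} {v} → E-sym cut {u} {v}) proj₁
        λ EC⊆ → proj₂ (EC⊆ (p-EC i)) (inj₁ refl)

    abstract
      c : Fin n → Bool
      c = proj₁ colouring

      c-proper : Colouring (E cut) c
      c-proper = proj₂ colouring

    p-cut : ∀ {t} → suc t < L → E cut (p (suc i + t)) (p (suc i + suc t))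
    p-cut {t} t<L = subst (λ j → E cut (p j) (p (suc i + suc t))) (+-suc i t)
      (EC⇒E (p-EC (i + suc t)) , p-edges-distinct C-odd i z<s t<L)

    c-alternates : ∀ t → t < L → c (p (suc i + t)) ≡ odd t xor c (p (suc i))
    c-alternates zero    _   = cong (c ∘ p) (+-identityʳ (suc i))
    c-alternates (suc t) t<L = begin
      c (p (suc i + suc t))          ≡⟨ Bool.¬-not (c-proper (p-cut t<L) ∘ sym) ⟩
      not (c (p (suc i + t)))        ≡⟨ cong not (c-alternates t (ℕ.<-trans (ℕ.n<1+n t) t<L)) ⟩
      not (odd t xor c (p (suc i)))  ≡⟨ Bool.not-distribˡ-xor (odd t) _ ⟩
      not (odd t) xor c (p (suc i))  ∎
      where open ≡-Reasoning

    -- What remains of `C` is a path with the even number `L` minus 1 of edges, so its ends receive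
    -- the same colour.
    c-ends : c (p i) ≡ c (p (suc i))
    c-ends = begin
      c (p i)                                  ≡⟨ cong c (p-period i) ⟨
      c (p (i + L))                            ≡⟨ cong (c ∘ p) (+-suc i _) ⟩
      c (p (suc i + length rest))              ≡⟨ c-alternates _ (ℕ.n<1+n _) ⟩
      odd (length rest) xor c (p (suc i))
        ≡⟨ cong (_xor c (p (suc i))) (trans (sym (Bool.not-involutive _)) (cong not (L-odd C-odd))) ⟩
      c (p (suc i))                            ∎
      where
      open ≡-Reasoning
      open Cycle C using (rest)

-- Double negation

-- Infinite descent along `f`. As `P` need not be decidable, the minimum exists only up to double
-- negation.
¬¬-minimal : {A : Set} {P : A → Set} (f : A → ℕ) → ∃ P →
             ¬ ¬ (∃[ a ] P a × (∀ b → P b → f a ≤ f b))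
¬¬-minimal {P = P} f (a₀ , p₀) ¬min = descend a₀ p₀ (<-wellFounded _)
  where
  descend : ∀ a → P a → Acc _<_ (f a) → ⊥
  descend a p (acc rs) = ¬min (a , p , λ b q → ℕ.≮⇒≥ λ fb<fa → descend b q (rs fb<fa))

¬¬-decidable : ∀ {n} (P : Pred (Fin n) 0ℓ) → ¬ ¬ Pred.Decidable P
¬¬-decidable {zero}  P ¬dec = ¬dec λ ()
¬¬-decidable {suc n} P ¬dec = ¬¬-excluded-middle λ p₀ → ¬¬-decidable (P ∘ suc) λ p →
  ¬dec λ { zero → p₀ ; (suc v) → p v }

-- Sums of indicator functions

open Sum +-0-commutativeMonoid
  using (sum; sum-cong-≗; ∑-distrib-+; sum-permute)

𝟙 : {P : Set} → Dec P → ℕ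
𝟙 (yes _) = 1
𝟙 (no _)  = 0

𝟙-yes : {P : Set} (p? : Dec P) → P → 𝟙 p? ≡ 1
𝟙-yes (yes _) _ = refl
𝟙-yes (no ¬p) p = contradiction p ¬p

𝟙-no : {P : Set} (p? : Dec P) → ¬ P → 𝟙 p? ≡ 0
𝟙-no (yes p) ¬p = contradiction p ¬p
𝟙-no (no _)  _  = refl

𝟙-mono : {P Q : Set} (p? : Dec P) (q? : Dec Q) → (P → Q) → 𝟙 p? ≤ 𝟙 q?
𝟙-mono (no _)  _       _   = z≤n
𝟙-mono (yes _) (yes _) _   = ≤-refl
𝟙-mono (yes p) (no ¬q) p⇒q = contradiction (p⇒q p) ¬q

sum-mono : ∀ {n} {f g : Fin n → ℕ} → (∀ v → f v ≤ g v) → sum f ≤ sum g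
sum-mono {zero}  f≤g = z≤n
sum-mono {suc n} f≤g = +-mono-≤ (f≤g zero) (sum-mono (f≤g ∘ suc))

-- A strict inequality at one position would make the sum of `g` strictly larger. This extracts
-- pointwise information from tight counting bounds.
sum-tight : ∀ {n} {f g : Fin n → ℕ} → (∀ v → f v ≤ g v) → sum g ≤ sum f → ∀ v → g v ≤ f v
sum-tight {suc n} {f} {g} f≤g Σg≤Σf zero = ℕ.≮⇒≥ λ f₀<g₀ →
  ℕ.<⇒≱ (ℕ.+-mono-<-≤ f₀<g₀ (sum-mono (f≤g ∘ suc))) Σg≤Σf
sum-tight {suc n} {f} {g} f≤g Σg≤Σf (suc v) = sum-tight (f≤g ∘ suc)
  (ℕ.≮⇒≥ λ Σ< → ℕ.<⇒≱ (ℕ.+-mono-≤-< (f≤g zero) Σ<) Σg≤Σf) v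

sum-involution : ∀ {n} (f : Fin n → ℕ) {m : Fin n → Fin n} → (∀ v → m (m v) ≡ v) →
                 sum (f ∘ m) ≡ sum f
sum-involution f {m} m-inv = sym (sum-permute f (permutation m m (λ v → m-inv v) (λ v → m-inv v)))

sum-0 : ∀ {n} {f : Fin n → ℕ} → (∀ v → f v ≡ 0) → sum f ≡ 0
sum-0 {zero}  _   = refl
sum-0 {suc n} f≡0 = cong₂ _+_ (f≡0 zero) (sum-0 (f≡0 ∘ suc))

sum-𝟙-≟ : ∀ {n} (x : Fin n) → sum (λ v → 𝟙 (v ≟ x)) ≡ 1
sum-𝟙-≟ {suc n} zero = cong suc (sum-0 {n} λ v → 𝟙-no (suc v ≟ zero) λ ())
sum-𝟙-≟ {suc n} (suc x) = trans (sum-cong-≗ same) (sum-𝟙-≟ x)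
  where
  same : ∀ v → 𝟙 (suc v ≟ suc x) ≡ 𝟙 (v ≟ x)
  same v with v ≟ x
  ... | yes _ = refl
  ... | no _  = refl

∣∣≡sum : ∀ {n} (S : Subset n) → ∣ S ∣ ≡ sum (λ v → 𝟙 (v ∈? S))
∣∣≡sum []            = refl
∣∣≡sum (b ∷ S) = trans (head b) (cong (𝟙 (zero ∈? (b ∷ S)) +_) (trans (∣∣≡sum S) (sum-cong-≗ same)))
  where
  head : ∀ b → ∣ b ∷ S ∣ ≡ 𝟙 (zero ∈? (b ∷ S)) + ∣ S ∣
  head true  = refl
  head false = refl
  same : ∀ v → 𝟙 (v ∈? S) ≡ 𝟙 (suc v ∈? (b ∷ S))
  same v with v ∈? S
  ... | yes _ = refl
  ... | no _  = refl

-- Matchings as involutions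

module _ {n} (R : Rel (Fin n) 0ℓ) where

  -- m v is the partner of v, or v itself if v is exposed.
  record Mate (m : Fin n → Fin n) : Set where
    field
      involutive : ∀ v → m (m v) ≡ v
      edge       : ∀ {v} → m v ≢ v → R v (m v)

-- For a matching of a graph this also counts the elements of `Fin n` that are not vertices. They
-- are fixed by every such matching, so minimizing `exposed` still means maximizing the matching.
exposed : ∀ {n} → (Fin n → Fin n) → ℕ
exposed m = sum λ v → 𝟙 (m v ≟ v)

module _ {n} (R : Rel (Fin n) 0ℓ) where

  record Maximum (m : Fin n → Fin n) : Set where
    field
      mate    : Mate R m
      minimal : ∀ m′ → Mate R m′ → exposed m ≤ exposed m′
    open Mate mate public

  ¬¬-maximum : ¬ ¬ ∃ Maximum
  ¬¬-maximum = ¬¬-map (λ (m , M , min) → m , record { mate = M ; minimal = min })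
    (¬¬-minimal exposed (id , record { involutive = λ _ → refl ; edge = λ v≢v → contradiction refl v≢v }))

  Missable : Pred (Fin n) 0ℓ
  Missable v = ∃[ m ] Maximum m × m v ≡ v

mate-mono : ∀ {n} {R S : Rel (Fin n) 0ℓ} → (∀ {u v} → R u v → S u v) →
            ∀ {m} → Mate R m → Mate S m
mate-mono R⊆S M = record { involutive = involutive ; edge = R⊆S ∘ edge }
  where open Mate M

maximum-≤ : ∀ {n} {R : Rel (Fin n) 0ℓ} {m m′} → Maximum R m → Mate R m′ →
            exposed m′ ≤ exposed m → Maximum R m′
maximum-≤ M M′ ≤m = record
  { mate = M′ ; minimal = λ m″ M″ → ≤-trans ≤m (Maximum.minimal M m″ M″) }

module _ {n} {O : Pred (Fin n) 0ℓ} (O? : Pred.Decidable O) where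

  private
    choose : ∀ {v} → Dec (O v) → Fin n → Fin n → Fin n
    choose (yes _) a b = a
    choose (no _)  a b = b

  splice : (m m′ : Fin n → Fin n) → Fin n → Fin n
  splice m m′ v = choose (O? v) (m v) (m′ v)

  splice-in : ∀ m m′ {v} → O v → splice m m′ v ≡ m v
  splice-in m m′ {v} v∈O with O? v
  ... | yes _  = refl
  ... | no v∉O = contradiction v∈O v∉O

  splice-out : ∀ m m′ {v} → ¬ O v → splice m m′ v ≡ m′ v
  splice-out m m′ {v} v∉O with O? v
  ... | yes v∈O = contradiction v∈O v∉O
  ... | no _    = refl

  -- At each vertex the two splices take the values of `m` and `m′` in one order or the other.
  splice-exposed : ∀ m m′ → exposed (splice m m′) + exposed (splice m′ m) ≡ exposed m + exposed m′
  splice-exposed m m′ = begin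
    exposed (splice m m′) + exposed (splice m′ m)  ≡⟨ ∑-distrib-+ f g ⟨
    sum (λ v → f v + g v)                          ≡⟨ sum-cong-≗ pointwise ⟩
    sum (λ v → 𝟙 (m v ≟ v) + 𝟙 (m′ v ≟ v))         ≡⟨ ∑-distrib-+ (λ v → 𝟙 (m v ≟ v)) _ ⟩
    exposed m + exposed m′                         ∎
    where
    open ≡-Reasoning
    f g : Fin n → ℕ
    f v = 𝟙 (splice m m′ v ≟ v)
    g v = 𝟙 (splice m′ m v ≟ v)
    pointwise : ∀ v → f v + g v ≡ 𝟙 (m v ≟ v) + 𝟙 (m′ v ≟ v)
    pointwise v with O? v
    ... | yes _ = refl
    ... | no _  = +-comm (𝟙 (m′ v ≟ v)) _

  module _ {R : Rel (Fin n) 0ℓ} {m m′ : Fin n → Fin n} (M : Mate R m) (M′ : Mate R m′)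
           (m-closed : ∀ {v} → O v → O (m v)) (m′-closed : ∀ {v} → O v → O (m′ v)) where

    -- Closure under both matchings keeps each matching edge inside `O` or inside its complement, so
    -- the two halves fit together.
    splice-mate : Mate R (splice m m′)
    splice-mate = record { involutive = inv ; edge = edge }
      where
      inv : ∀ v → splice m m′ (splice m m′ v) ≡ v
      inv v with O? v
      ... | yes v∈O = trans (splice-in m m′ (m-closed v∈O)) (Mate.involutive M v)
      ... | no v∉O  = trans (splice-out m m′ λ m′v∈O → v∉O (subst O (Mate.involutive M′ v) (m′-closed m′v∈O)))
                            (Mate.involutive M′ v)
      edge : ∀ {v} → splice m m′ v ≢ v → R v (splice m m′ v)
      edge {v} ≢v with O? v
      ... | yes _ = Mate.edge M ≢v
      ... | no _  = Mate.edge M′ ≢v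

exposed-+2 : ∀ {n} {m m′ : Fin n → Fin n} {x w} → x ≢ w → m x ≡ x → m w ≡ w →
             m′ x ≢ x → m′ w ≢ w → (∀ {v} → v ≢ x → v ≢ w → m′ v ≡ m v) →
             exposed m ≡ exposed m′ + 2
exposed-+2 {n} {m} {m′} {x} {w} x≢w mx mw m′x m′w agree = begin
  exposed m                                    ≡⟨ sum-cong-≗ pointwise ⟩
  sum (λ v → 𝟙 (m′ v ≟ v) + (𝟙 (v ≟ x) + 𝟙 (v ≟ w)))
    ≡⟨ ∑-distrib-+ (λ v → 𝟙 (m′ v ≟ v)) _ ⟩
  exposed m′ + sum {n} (λ v → 𝟙 (v ≟ x) + 𝟙 (v ≟ w))
    ≡⟨ cong (exposed m′ +_) (∑-distrib-+ (λ v → 𝟙 (v ≟ x)) _) ⟩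
  exposed m′ + (sum (λ v → 𝟙 (v ≟ x)) + sum (λ v → 𝟙 (v ≟ w)))
    ≡⟨ cong₂ (λ a b → exposed m′ + (a + b)) (sum-𝟙-≟ x) (sum-𝟙-≟ w) ⟩
  exposed m′ + 2                               ∎
  where
  open ≡-Reasoning
  pointwise : ∀ v → 𝟙 (m v ≟ v) ≡ 𝟙 (m′ v ≟ v) + (𝟙 (v ≟ x) + 𝟙 (v ≟ w))
  pointwise v with v ≟ x | v ≟ w
  ... | yes refl | yes refl = contradiction refl x≢w
  ... | yes refl | no _  rewrite 𝟙-yes (m v ≟ v) mx | 𝟙-no (m′ v ≟ v) m′x = refl
  ... | no _  | yes refl rewrite 𝟙-yes (m v ≟ v) mw | 𝟙-no (m′ v ≟ v) m′w = refl
  ... | no ≢x | no ≢w    rewrite agree ≢x ≢w = sym (ℕ.+-identityʳ _)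

module _ {n} (x w : Fin n) (m : Fin n → Fin n) where

  join : Fin n → Fin n
  join v with v ≟ x | v ≟ w
  ... | yes _ | _     = w
  ... | no _  | yes _ = x
  ... | no _  | no _  = m v

  join-x : join x ≡ w
  join-x with x ≟ x
  ... | yes _  = refl
  ... | no x≢x = contradiction refl x≢x

  join-w : x ≢ w → join w ≡ x
  join-w x≢w with w ≟ x | w ≟ w
  ... | yes w≡x | _      = contradiction (sym w≡x) x≢w
  ... | no _    | yes _  = refl
  ... | no _    | no w≢w = contradiction refl w≢w

  join-other : ∀ {v} → v ≢ x → v ≢ w → join v ≡ m v
  join-other {v} v≢x v≢w with v ≟ x | v ≟ w
  ... | yes v≡x | _       = contradiction v≡x v≢x
  ... | no _    | yes v≡w = contradiction v≡w v≢w
  ... | no _    | no _    = refl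

  module _ {R : Rel (Fin n) 0ℓ} (M : Mate R m) (R-sym : Symmetric R) (e : R x w) (x≢w : x ≢ w)
           (mx : m x ≡ x) (mw : m w ≡ w) where

    open Mate M

    private
      m-other : ∀ {v y} → m y ≡ y → v ≢ y → m v ≢ y
      m-other my v≢y mv≡y = v≢y (trans (sym (involutive _)) (trans (cong m mv≡y) my))

    join-mate : Mate R join
    join-mate = record { involutive = inv ; edge = edge′ }
      where
      inv : ∀ v → join (join v) ≡ v
      inv v with v ≟ x | v ≟ w
      ... | yes refl | _ = join-w x≢w
      ... | no _ | yes refl = join-x
      ... | no v≢x | no v≢w = trans (join-other (m-other mx v≢x) (m-other mw v≢w)) (involutive v)
      edge′ : ∀ {v} → join v ≢ v → R v (join v)
      edge′ {v} ≢v with v ≟ x | v ≟ w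
      ... | yes refl | _ = e
      ... | no _ | yes refl = R-sym e
      ... | no _ | no _ = edge ≢v

    join-exposed : exposed m ≡ exposed join + 2
    join-exposed = exposed-+2 x≢w mx mw (λ eq → x≢w (trans (sym eq) join-x))
      (λ eq → x≢w (trans (sym (join-w x≢w)) eq)) join-other

module _ {n} (w : Fin n) (m : Fin n → Fin n) where

  part : Fin n → Fin n
  part v with v ≟ w | v ≟ m w
  ... | yes _ | _     = v
  ... | no _  | yes _ = v
  ... | no _  | no _  = m v

  part-w : part w ≡ w
  part-w with w ≟ w
  ... | yes _  = refl
  ... | no w≢w = contradiction refl w≢w

  part-mw : part (m w) ≡ m w
  part-mw with m w ≟ w | m w ≟ m w
  ... | yes _ | _     = refl
  ... | no _  | yes _ = refl
  ... | no _  | no ≢  = contradiction refl ≢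

  part-other : ∀ {v} → v ≢ w → v ≢ m w → part v ≡ m v
  part-other {v} v≢w v≢mw with v ≟ w | v ≟ m w
  ... | yes v≡w | _        = contradiction v≡w v≢w
  ... | no _    | yes v≡mw = contradiction v≡mw v≢mw
  ... | no _    | no _     = refl

  module _ {R : Rel (Fin n) 0ℓ} (M : Mate R m) where

    open Mate M

    part-mate : Mate R part
    part-mate = record { involutive = inv ; edge = edge′ }
      where
      inv : ∀ v → part (part v) ≡ v
      inv v with v ≟ w | v ≟ m w
      ... | yes refl | _ = part-w
      ... | no _ | yes refl = part-mw
      ... | no v≢w | no v≢mw = trans
        (part-other (λ mv≡w → v≢mw (trans (sym (involutive v)) (cong m mv≡w)))
                    (λ mv≡mw → v≢w (trans (sym (involutive v)) (trans (cong m mv≡mw) (involutive w)))))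
        (involutive v)
      edge′ : ∀ {v} → part v ≢ v → R v (part v)
      edge′ {v} ≢v with v ≟ w | v ≟ m w
      ... | yes _ | _     = contradiction refl ≢v
      ... | no _  | yes _ = contradiction refl ≢v
      ... | no _  | no _  = edge ≢v

    part-exposed : m w ≢ w → exposed part ≡ exposed m + 2
    part-exposed mw≢w = exposed-+2 mw≢w part-mw part-w
      (λ mmw≡mw → mw≢w (trans (sym mmw≡mw) (involutive w))) mw≢w
      (λ v≢mw v≢w → sym (part-other v≢w v≢mw))

𝟙-cong : {P Q : Set} (p? : Dec P) (q? : Dec Q) → (P → Q) → (Q → P) → 𝟙 p? ≡ 𝟙 q?
𝟙-cong p? q? f g = ℕ.≤-antisym (𝟙-mono p? q? f) (𝟙-mono q? p? g)

mate-refine : ∀ {n} {R S : Rel (Fin n) 0ℓ} {m} → Mate R m →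
              (∀ {v} → m v ≢ v → S v (m v)) → Mate S m
mate-refine M edge = record { involutive = Mate.involutive M ; edge = edge }

id-mate : ∀ {n} {R : Rel (Fin n) 0ℓ} → Mate R id
id-mate = record { involutive = λ _ → refl ; edge = λ v≢v → contradiction refl v≢v }

module _ {n} {O : Pred (Fin n) 0ℓ} (O? : Pred.Decidable O) {a b : Fin n → Fin n} where

  -- The two splices expose as many vertices in total as `a` and `b`, so what one loses the other
  -- gains. With a maximum matching on the left, this shows that an exchanged matching is again
  -- maximum.
  splice-≤ʳ : exposed a ≤ exposed (splice O? b a) → exposed (splice O? a b) ≤ exposed b
  splice-≤ʳ a≤ = ℕ.+-cancelʳ-≤ (exposed a) _ _ (≤-trans (ℕ.+-monoʳ-≤ (exposed (splice O? a b)) a≤)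
    (≤-reflexive (trans (splice-exposed O? a b) (+-comm (exposed a) _))))

  splice-≤ˡ : exposed b ≤ exposed (splice O? b a) → exposed (splice O? a b) ≤ exposed a
  splice-≤ˡ b≤ = ℕ.+-cancelʳ-≤ (exposed b) _ _ (≤-trans (ℕ.+-monoʳ-≤ (exposed (splice O? a b)) b≤)
    (≤-reflexive (splice-exposed O? a b)))

mate-closed : ∀ {n} {R : Rel (Fin n) 0ℓ} {m} → Mate R m → (O : Pred (Fin n) 0ℓ) →
              (∀ {u v} → R u v → O u → O v) → ∀ {v} → O v → O (m v)
mate-closed {m = m} M O R-closed {v} v∈O with m v ≟ v
... | yes mv≡v = subst O (sym mv≡v) v∈O
... | no mv≢v  = R-closed (Mate.edge M mv≢v) v∈O

-- Exchange along alternating orbits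

module _ {n} {R : Rel (Fin n) 0ℓ} (R-sym : Symmetric R) {c : Fin n → Bool} (c-proper : Colouring R c)
         {a b : Fin n → Fin n} (A : Mate R a) (B : Mate R b) {x : Fin n} (bx : b x ≡ x) where

  private
    -- The colour of the current vertex decides which matching continues the alternating path from
    -- `x`, so the path becomes iteration of a single function.
    next : Fin n → Fin n
    next v with c v Bool.≟ c x
    ... | yes _ = a v
    ... | no _  = b v

  -- The vertices x, a x, b (a x), a (b (a x)), …; the invariant Backward below
  -- makes this set closed under both a and b.
  Orbit : Pred (Fin n) 0ℓ
  Orbit = Star (λ u v → v ≡ next u) x

  Orbit? : Pred.Decidable Orbit
  Orbit? = star? _ (λ u v → v ≟ next u) x

  private
    next-same : ∀ {v} → c v ≡ c x → next v ≡ a v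
    next-same {v} eq with c v Bool.≟ c x
    ... | yes _ = refl
    ... | no ≢  = contradiction eq ≢

    next-diff : ∀ {v} → c v ≢ c x → next v ≡ b v
    next-diff {v} ≢ with c v Bool.≟ c x
    ... | yes eq = contradiction eq ≢
    ... | no _   = refl

    step : ∀ {v} → Orbit v → Orbit (next v)
    step o = o ◅◅ (refl ◅ ε)

    switch : ∀ {m v} → Mate R m → m v ≢ v → c v ≢ c x → c (m v) ≡ c x
    switch M ≢v v≢x = trans (Bool.¬-not (c-proper (Mate.edge M ≢v) ∘ sym)) (sym (Bool.¬-not (v≢x ∘ sym)))

    -- Locates the predecessor: vertices coloured like `x` are entered by `b`, the others by `a`
    -- along a genuine edge. The start is covered because `b` fixes `x`.
    Backward : Pred (Fin n) 0ℓ
    Backward v = Orbit v × (c v ≡ c x → Orbit (b v)) × (c v ≢ c x → Orbit (a v) × a v ≢ v)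

    advance : ∀ {v} → Backward v → Backward (next v)
    advance {v} (o , back , back′) with c v Bool.≟ c x
    ... | yes eq with a v ≟ v
    ...   | yes av≡v = subst Backward (sym av≡v) (o , back , back′)
    ...   | no av≢v = subst Orbit (next-same eq) (step o)
            , (λ eq′ → contradiction (trans eq (sym eq′)) (c-proper (Mate.edge A av≢v)))
            , (λ _ → subst Orbit (sym (Mate.involutive A v)) o
                   , λ eq′ → av≢v (trans (sym eq′) (Mate.involutive A v)))
    advance {v} (o , back , back′) | no ≢ with b v ≟ v
    ... | yes bv≡v = subst Backward (sym bv≡v) (o , back , back′)
    ... | no bv≢v = subst Orbit (next-diff ≢) (step o)
          , (λ _ → subst Orbit (sym (Mate.involutive B v)) o)
          , (λ ≢′ → contradiction (switch B bv≢v ≢) ≢′)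

    orbit⇒backward : ∀ {v} → Orbit v → Backward v
    orbit⇒backward = go (ε , (λ _ → subst Orbit (sym bx) ε) , λ ≢ → contradiction refl ≢)
      where
      go : ∀ {u v} → Backward u → Star (λ u v → v ≡ next u) u v → Backward v
      go r ε          = r
      go r (refl ◅ s) = go (advance r) s

  orbit-a : ∀ {v} → Orbit v → Orbit (a v)
  orbit-a {v} o with c v Bool.≟ c x
  ... | yes eq = subst Orbit (next-same eq) (step o)
  ... | no ≢   = proj₁ (proj₂ (proj₂ (orbit⇒backward o)) ≢)

  orbit-b : ∀ {v} → Orbit v → Orbit (b v)
  orbit-b {v} o with c v Bool.≟ c x
  ... | yes eq = proj₁ (proj₂ (orbit⇒backward o)) eq
  ... | no ≢   = subst Orbit (next-diff ≢) (step o)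

  orbit-covered : ∀ {v} → Orbit v → c v ≢ c x → a v ≢ v
  orbit-covered o ≢ = proj₂ (proj₂ (proj₂ (orbit⇒backward o)) ≢)

module _ {n} {R : Rel (Fin n) 0ℓ} (R-sym : Symmetric R) where

  maximum-no-join : ∀ {m} → Maximum R m → ∀ {x w} → R x w → x ≢ w → m x ≡ x → m w ≢ w
  maximum-no-join {m} M e x≢w mx mw = ℕ.<⇒≱ (ℕ.m<m+n (exposed (join _ _ m)) {2} (s≤s z≤n))
    (subst (_≤ exposed (join _ _ m)) (join-exposed _ _ m mate R-sym e x≢w mx mw)
      (minimal _ (join-mate _ _ m mate R-sym e x≢w mx mw)))
    where open Maximum M

  module _ {c : Fin n → Bool} (c-proper : Colouring R c)
           {m} (M : Maximum R m) {x w} (x-miss : Missable R x) (e : R x w) where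

    private
      open Maximum M
      m′ = proj₁ x-miss
      M′ = proj₁ (proj₂ x-miss)
      m′x = proj₂ (proj₂ x-miss)

      x≢w : x ≢ w
      x≢w refl = c-proper e refl

      -- Exchanging m″, which misses w, with m′ along the orbit of x gives a
      -- matching m₁ that misses both x and w and can be extended by the edge xw.
      module Exchange {m″} (M″ : Mate R m″) (m″w : m″ w ≡ w) where

        O  = Orbit R-sym c-proper M″ (Maximum.mate M′) m′x
        O? = Orbit? R-sym c-proper M″ (Maximum.mate M′) m′x
        closed″ : ∀ {v} → O v → O (m″ v)
        closed″ = orbit-a R-sym c-proper M″ (Maximum.mate M′) m′x
        closed′ : ∀ {v} → O v → O (m′ v)
        closed′ = orbit-b R-sym c-proper M″ (Maximum.mate M′) m′x

        w∉O : ¬ O w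
        w∉O o = orbit-covered R-sym c-proper M″ (Maximum.mate M′) m′x o (c-proper e ∘ sym) m″w

        m₁ m₂ m₁⁺ : Fin n → Fin n
        m₁ = splice O? m′ m″
        m₂ = splice O? m″ m′
        m₁⁺ = join x w m₁

        M₁ : Mate R m₁
        M₁ = splice-mate O? (Maximum.mate M′) M″ closed′ closed″
        M₂ : Mate R m₂
        M₂ = splice-mate O? M″ (Maximum.mate M′) closed″ closed′

        m₁x : m₁ x ≡ x
        m₁x = trans (splice-in O? m′ m″ ε) m′x
        m₁w : m₁ w ≡ w
        m₁w = trans (splice-out O? m′ m″ w∉O) m″w

        M₁⁺ : Mate R m₁⁺
        M₁⁺ = join-mate x w m₁ M₁ R-sym e x≢w m₁x m₁w

        total : exposed m₁⁺ + 2 + exposed m₂ ≡ exposed m + exposed m″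
        total = begin
          exposed m₁⁺ + 2 + exposed m₂ ≡⟨ cong (_+ exposed m₂) (join-exposed x w m₁ M₁ R-sym e x≢w m₁x m₁w) ⟨
          exposed m₁ + exposed m₂      ≡⟨ splice-exposed O? m′ m″ ⟩
          exposed m′ + exposed m″      ≡⟨ cong (_+ exposed m″)
                                               (ℕ.≤-antisym (Maximum.minimal M′ _ mate) (minimal _ (Maximum.mate M′))) ⟩
          exposed m + exposed m″       ∎
          where open ≡-Reasoning

    -- Otherwise the exchange with `m″` equal to `m` yields `m₁⁺` and `m₂`, which together expose
    -- two vertices fewer than two maximum matchings.
    neighbour-covered : m w ≢ w
    neighbour-covered mw = ℕ.<-irrefl (sym X.total) (ℕ.+-mono-<-≤
        (ℕ.≤-<-trans (minimal _ X.M₁⁺) (ℕ.m<m+n (exposed X.m₁⁺) {2} (s≤s z≤n))) (minimal _ X.M₂))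
      where module X = Exchange mate mw

    -- The exchange is applied to `m` without its edge at `w`. The loss of that edge is balanced by
    -- the gain of `xw`, so `m₁⁺` and `m₂` are both maximum; one of them misses `m w`, depending on
    -- whether the orbit contains it.
    partner-missable : Missable R (m w)
    partner-missable = cases (X.O? (m w))
      where
      module X = Exchange (part-mate w m mate) (part-w w m)
      open ℕ.≤-Reasoning
      m₂≤m : exposed X.m₂ ≤ exposed m
      m₂≤m = ℕ.+-cancelˡ-≤ (exposed m + 2) _ _ (begin
        exposed m + 2 + exposed X.m₂      ≤⟨ ℕ.+-monoˡ-≤ (exposed X.m₂) (ℕ.+-monoˡ-≤ 2 (minimal _ X.M₁⁺)) ⟩
        exposed X.m₁⁺ + 2 + exposed X.m₂  ≡⟨ X.total ⟩
        exposed m + exposed (part w m)    ≡⟨ cong (exposed m +_) (part-exposed w m mate neighbour-covered) ⟩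
        exposed m + (exposed m + 2)       ≡⟨ +-comm (exposed m) _ ⟩
        exposed m + 2 + exposed m         ∎)
      m₁⁺≤m : exposed X.m₁⁺ ≤ exposed m
      m₁⁺≤m = ℕ.+-cancelʳ-≤ (2 + exposed m) _ _ (begin
        exposed X.m₁⁺ + (2 + exposed m)   ≡⟨ +-assoc (exposed X.m₁⁺) 2 _ ⟨
        exposed X.m₁⁺ + 2 + exposed m     ≤⟨ ℕ.+-monoʳ-≤ (exposed X.m₁⁺ + 2) (minimal _ X.M₂) ⟩
        exposed X.m₁⁺ + 2 + exposed X.m₂  ≡⟨ X.total ⟩
        exposed m + exposed (part w m)    ≡⟨ cong (exposed m +_) (part-exposed w m mate neighbour-covered) ⟩
        exposed m + (exposed m + 2)       ≡⟨ cong (exposed m +_) (+-comm (exposed m) 2) ⟩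
        exposed m + (2 + exposed m)       ∎)
      cases : Dec (X.O (m w)) → Missable R (m w)
      cases (yes o) = X.m₂ , maximum-≤ M X.M₂ m₂≤m
        , trans (splice-in X.O? (part w m) m′ o) (part-mw w m)
      cases (no ¬o) = X.m₁⁺ , maximum-≤ M X.M₁⁺ m₁⁺≤m
        , trans (join-other x w _ (λ { refl → ¬o ε }) neighbour-covered)
                (trans (splice-out X.O? m′ (part w m) ¬o) (part-mw w m))

-- Kőnig–Egerváry graphs

elements : ∀ {n} → Subset n → List (Fin n)
elements []          = []
elements (true ∷ S)  = zero ∷ map suc (elements S)
elements (false ∷ S) = map suc (elements S)

length-elements : ∀ {n} (S : Subset n) → length (elements S) ≡ ∣ S ∣
length-elements []          = refl
length-elements (true ∷ S)  = cong suc (trans (length-map suc (elements S)) (length-elements S))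
length-elements (false ∷ S) = trans (length-map suc (elements S)) (length-elements S)

elements-∈ : ∀ {n} (S : Subset n) → All (_∈ S) (elements S)
elements-∈ []          = []
elements-∈ (true ∷ S)  = Vec.here ∷ All.map⁺ (All.map Vec.there (elements-∈ S))
elements-∈ (false ∷ S) = All.map⁺ (All.map Vec.there (elements-∈ S))

elements-unique : ∀ {n} (S : Subset n) → Unique (elements S)
elements-unique []          = []
elements-unique (true ∷ S)  = All.map⁺ (All.universal (λ _ ()) _) ∷ Unique.map⁺ suc-injective (elements-unique S)
elements-unique (false ∷ S) = Unique.map⁺ suc-injective (elements-unique S)

unique-length-≤ : ∀ {n} {xs : List (Fin n)} → Unique xs → ∀ (S : Subset n) → All (_∈ S) xs → length xs ≤ ∣ S ∣
unique-length-≤ []       S []          = z≤n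
unique-length-≤ (x∉ ∷ U) S (x∈S ∷ xs⊆S) = ≤-trans
  (s≤s (unique-length-≤ U (S - _) (All.map (λ (x≢y , y∈S) → x∈p∧x≢y⇒x∈p-y y∈S (x≢y ∘ sym)) (All.zip (x∉ , xs⊆S)))))
  (x∈p⇒∣p-x∣<∣p∣ x∈S)

module _ {n} (G : Graph n) where

  private
    complement? : (S : Subset n) → Pred.Decidable (λ v → v ∈ V G × v ∉ S)
    complement? S v = (v ∈? V G) ×-dec ¬? (v ∈? S)

    ∣S∣+∣V∖S∣ : ∀ {S} → Independent G S → ∣ S ∣ + ∣ comprehension (complement? S) ∣ ≡ order G
    ∣S∣+∣V∖S∣ {S} (S⊆V , _) = begin
      ∣ S ∣ + ∣ comprehension (complement? S) ∣
        ≡⟨ cong₂ _+_ (∣∣≡sum S) (∣∣≡sum (comprehension (complement? S))) ⟩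
      sum (λ v → 𝟙 (v ∈? S)) + sum (λ v → 𝟙 (v ∈? comprehension (complement? S)))
        ≡⟨ ∑-distrib-+ (λ v → 𝟙 (v ∈? S)) _ ⟨
      sum (λ v → 𝟙 (v ∈? S) + 𝟙 (v ∈? comprehension (complement? S)))
        ≡⟨ sum-cong-≗ pointwise ⟩
      sum (λ v → 𝟙 (v ∈? V G))
        ≡⟨ ∣∣≡sum (V G) ⟨
      order G ∎
      where
      open ≡-Reasoning
      pointwise : ∀ v → 𝟙 (v ∈? S) + 𝟙 (v ∈? comprehension (complement? S)) ≡ 𝟙 (v ∈? V G)
      pointwise v with v ∈? S | v ∈? comprehension (complement? S) | v ∈? V G
      ... | yes v∈S | yes v∈C | _      = contradiction v∈S (proj₂ (∈-comprehension⁻ (complement? S) v∈C))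
      ... | yes v∈S | no _    | yes _  = refl
      ... | yes v∈S | no _    | no v∉V = contradiction (S⊆V v∈S) v∉V
      ... | no _    | yes _   | yes _  = refl
      ... | no _    | yes v∈C | no v∉V = contradiction (proj₁ (∈-comprehension⁻ (complement? S) v∈C)) v∉V
      ... | no v∉S  | no v∉C  | yes v∈V = contradiction (∈-comprehension⁺ (complement? S) (v∈V , v∉S)) v∉C
      ... | no _    | no _    | no _   = refl

  -- Each matching edge has an end outside `T`, and disjointness makes the chosen ends distinct.
  weak-duality : ∀ {T M} → Independent G T → Matching G M → ∣ T ∣ + length M ≤ order G
  weak-duality {T} {M} T-ind (edges , disjoint) = begin
    ∣ T ∣ + length M                            ≡⟨ cong (∣ T ∣ +_) (length-map outer M) ⟨
    ∣ T ∣ + length (map outer M)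
      ≤⟨ ℕ.+-monoʳ-≤ ∣ T ∣ (unique-length-≤ unique _ (All.map⁺ (All.map outer∈ edges))) ⟩
    ∣ T ∣ + ∣ comprehension (complement? T) ∣  ≡⟨ ∣S∣+∣V∖S∣ T-ind ⟩
    order G                                     ∎
    where
    open ℕ.≤-Reasoning
    outer : Fin n × Fin n → Fin n
    outer (u , v) with u ∈? T
    ... | yes _ = v
    ... | no _  = u
    outer∈ : ∀ {e} → E G (proj₁ e) (proj₂ e) → outer e ∈ comprehension (complement? T)
    outer∈ {u , v} e with u ∈? T
    ... | yes u∈T = ∈-comprehension⁺ (complement? T) (E⇒V G (E-sym G e) , λ v∈T → proj₂ T-ind u∈T v∈T e)
    ... | no u∉T  = ∈-comprehension⁺ (complement? T) (E⇒V G e , u∉T)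
    outer-≢ : ∀ {e f} → Disjoint e f → outer e ≢ outer f
    outer-≢ {a , b} {c , d} ((a≢c , a≢d) , (b≢c , b≢d)) with a ∈? T | c ∈? T
    ... | yes _ | yes _ = b≢d
    ... | yes _ | no _  = b≢c
    ... | no _  | yes _ = a≢d
    ... | no _  | no _  = a≢c
    unique : Unique (map outer M)
    unique = AllPairs.map⁺ (AllPairs.map outer-≢ disjoint)

  -- The edges from the vertices outside `S` to their partners form a matching for which weak
  -- duality is tight. Hence both `S` and this matching are optimal.
  könig-egerváry : ∀ {m S} → Mate (E G) m → Independent G S →
                   (∀ {v} → v ∈ V G → v ∉ S → m v ∈ S) → KőnigEgerváry G
  könig-egerváry {m} {S} mate S-ind paired =
    ∣ S ∣ , length M , (S , (S-ind , S-max) , refl) , (M , (M-matching , M-max) , refl) , total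
    where
    open Mate mate
    C = comprehension (complement? S)
    M : List (Fin n × Fin n)
    M = map (λ v → v , m v) (elements C)
    total : ∣ S ∣ + length M ≡ order G
    total = trans (cong (∣ S ∣ +_) (trans (length-map _ (elements C)) (length-elements C))) (∣S∣+∣V∖S∣ S-ind)
    matched : ∀ {v} → v ∈ C → v ∉ S × m v ∈ S
    matched v∈C with ∈-comprehension⁻ (complement? S) v∈C
    ... | v∈V , v∉S = v∉S , paired v∈V v∉S
    M-matching : Matching G M
    M-matching =
      All.map⁺ (All.map (λ v∈C → edge λ mv≡v → proj₁ (matched v∈C) (subst (_∈ S) mv≡v (proj₂ (matched v∈C))))
                        (elements-∈ C))
      , AllPairs.map⁺ (disjoint (elements-unique C) (elements-∈ C))
      where
      separate : ∀ {u v} → u ∈ C → u ≢ v × v ∈ C → Disjoint (u , m u) (v , m v)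
      separate {u} {v} u∈C (u≢v , v∈C) =
        (u≢v , λ u≡mv → proj₁ (matched u∈C) (subst (_∈ S) (sym u≡mv) (proj₂ (matched v∈C)))) ,
        ((λ mu≡v → proj₁ (matched v∈C) (subst (_∈ S) mu≡v (proj₂ (matched u∈C)))) ,
         λ mu≡mv → u≢v (trans (sym (involutive u)) (trans (cong m mu≡mv) (involutive v))))
      disjoint : ∀ {xs} → Unique xs → All (_∈ C) xs → AllPairs (λ u v → Disjoint (u , m u) (v , m v)) xs
      disjoint []       []           = []
      disjoint (x∉ ∷ U) (x∈C ∷ xs⊆C) = All.map (separate x∈C) (All.zip (x∉ , xs⊆C)) ∷ disjoint U xs⊆C
    S-max : ∀ T → Independent G T → ∣ T ∣ ≤ ∣ S ∣
    S-max T T-ind = ℕ.+-cancelʳ-≤ (length M) _ _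
      (≤-trans (weak-duality T-ind M-matching) (≤-reflexive (sym total)))
    M-max : ∀ M′ → Matching G M′ → length M′ ≤ length M
    M-max M′ M′-matching = ℕ.+-cancelˡ-≤ ∣ S ∣ _ _
      (≤-trans (weak-duality S-ind M′-matching) (≤-reflexive (sym total)))

-- Neighbourhoods and inequalities between differences

∈-N⁺ : ∀ {n} (G : Graph n) {A v w} → v ∈ A → E G v w → w ∈ N G A
∈-N⁺ G {A} v∈A e = ∈-comprehension⁺ (λ w → any? λ v → (v ∈? A) ×-dec E? G v w) (_ , v∈A , e)

∈-N⁻ : ∀ {n} (G : Graph n) {A w} → w ∈ N G A → ∃[ v ] v ∈ A × E G v w
∈-N⁻ G {A} = ∈-comprehension⁻ (λ w → any? λ v → (v ∈? A) ×-dec E? G v w)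

x∉p-x : ∀ {n} {p : Subset n} {x} → x ∉ p - x
x∉p-x {p = p} {x} x∈ = ℕ.<-irrefl (cong ∣_∣ (p─q─q≡p─q p ⁅ x ⁆)) (x∈p⇒∣p-x∣<∣p∣ x∈)

⊖-≤⁺ : ∀ a b c d → a + d ≤ c + b → a ⊖ b ℤ.≤ c ⊖ d
⊖-≤⁺ a b c d l = subst₂ ℤ._≤_
  (trans (cong₂ _⊖_ (+-comm a d) (+-comm b d)) (ℤ.+-cancelˡ-⊖ d a b))
  (trans (cong (_⊖ (b + d)) (+-comm c b)) (ℤ.+-cancelˡ-⊖ b c d))
  (ℤ.⊖-monoˡ-≤ (b + d) l)

⊖-≤⁻ : ∀ a b c d → a ⊖ b ℤ.≤ c ⊖ d → a + d ≤ c + b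
⊖-≤⁻ a b c d l = ℕ.≮⇒≥ λ c+b<a+d → ℤ.<⇒≱ (ℤ.⊖-monoˡ-< (b + d) c+b<a+d)
  (subst₂ ℤ._≤_
    (sym (trans (cong₂ _⊖_ (+-comm a d) (+-comm b d)) (ℤ.+-cancelˡ-⊖ d a b)))
    (sym (trans (cong (_⊖ (b + d)) (+-comm c b)) (ℤ.+-cancelˡ-⊖ b c d)))
    l)

2*-cancel-≤ : ∀ {a b} → a + a ≤ b + b → a ≤ b
2*-cancel-≤ {a} {b} l = ℕ.≮⇒≥ λ b<a → ℕ.<⇒≱ (ℕ.+-mono-< b<a b<a) l

-- Critical and maximum independent sets

core-stable : ∀ {n} (G : Graph n) {v} → ¬ ¬ core G v → core G v
core-stable G {v} ¬¬core S S-max = decidable-stable (v ∈? S) λ v∉S → ¬¬core λ v∈ → v∉S (v∈ S S-max)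

ker-stable : ∀ {n} (G : Graph n) {v} → ¬ ¬ ker G v → ker G v
ker-stable G {v} ¬¬ker A A-crit = decidable-stable (v ∈? A) λ v∉A → ¬¬ker λ v∈ → v∉A (v∈ A A-crit)

module _ {n} (K : Graph n) {Q : Pred (Fin n) 0ℓ} (Q? : Pred.Decidable Q) where

  -- Q will be the vertex set of the odd cycle, or empty for bipartite K. The
  -- free vertices are then exactly those of ker K and of core K.
  Outer : Rel (Fin n) 0ℓ
  Outer u v = E K u v × ¬ Q u × ¬ Q v

  Outer-sym : ∀ {u v} → Outer u v → Outer v u
  Outer-sym (e , u∉Q , v∉Q) = E-sym K e , v∉Q , u∉Q

  Free : Pred (Fin n) 0ℓ
  Free v = v ∈ V K × ¬ Q v × Missable Outer v

  -- A matching inside `Q`; `δ` is the number of vertices of `Q` it leaves over, namely 1 for the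
  -- odd cycle and 0 for empty `Q`.
  record InnerMate (δ : ℕ) (r : Fin n → Fin n) : Set where
    Unmatched : Pred (Fin n) 0ℓ
    Unmatched v = Q v × r v ≡ v
    unmatched? : Pred.Decidable Unmatched
    unmatched? v = Q? v ×-dec (r v ≟ v)
    field
      mate       : Mate (E K) r
      outside    : ∀ {v} → ¬ Q v → r v ≡ v
      deficiency : sum (λ v → 𝟙 (unmatched? v)) ≡ δ
    open Mate mate public
    closed : ∀ {v} → Q v → Q (r v)
    closed {v} v∈Q with Q? (r v)
    ... | yes rv∈Q = rv∈Q
    ... | no rv∉Q  = subst Q (trans (sym (involutive v)) (outside rv∉Q)) v∈Q

  -- Covers bipartite graphs and the almost bipartite case at once. Given an independent `T`,
  -- `inner` provides an inner matching whose leftover vertices avoid `T`; the counting bounds below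
  -- need this choice to depend on `T`.
  record Setting (δ : ℕ) : Set where
    field
      {r}      : Fin n → Fin n
      r-mate   : InnerMate δ r
      Q⊆V      : ∀ {v} → Q v → v ∈ V K
      c        : Fin n → Bool
      c-proper : ∀ {u v} → E K u v →
                 ¬ InnerMate.Unmatched r-mate u → ¬ InnerMate.Unmatched r-mate v → c u ≢ c v
      isolated : ∀ {u v} → Free u → Q v → ¬ E K u v
      inner    : ∀ {T} → Independent K T →
                 ¬ ¬ (∃[ s ] Σ[ s-mate ∈ InnerMate δ s ] (∀ {v} → InnerMate.Unmatched s-mate v → v ∉ T))

module _ {n} {K : Graph n} {Q : Pred (Fin n) 0ℓ} {Q? : Pred.Decidable Q}
         {δ r} (r-mate : InnerMate K Q? δ r) {m} (m-mate : Mate (Outer K Q?) m) where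

  private
    module r = InnerMate r-mate
    module m = Mate m-mate

  combine : Fin n → Fin n
  combine = splice Q? r m

  combine-mate : Mate (E K) combine
  combine-mate = splice-mate Q? r.mate (mate-mono proj₁ m-mate) r.closed
    λ {v} v∈Q → subst Q (sym (decidable-stable (m v ≟ v) λ ≢v → proj₁ (proj₂ (m.edge ≢v)) v∈Q)) v∈Q

  combine-in : ∀ {v} → Q v → combine v ≡ r v
  combine-in = splice-in Q? r m

  combine-out : ∀ {v} → ¬ Q v → combine v ≡ m v
  combine-out = splice-out Q? r m

module Optimal {n} {K : Graph n} {Q : Pred (Fin n) 0ℓ} {Q? : Pred.Decidable Q} {δ : ℕ}
         (setting : Setting K Q? δ) where

  open Setting setting

  private
    module r = InnerMate r-mate
    R = Outer K Q?
    F = Free K Q?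

  outer-proper : Colouring R c
  outer-proper (e , u∉Q , v∉Q) = c-proper e (u∉Q ∘ proj₁) (v∉Q ∘ proj₁)

  module _ {m} (M : Maximum R m) where

    private module M = Maximum M

    -- By `isolated`, `w` lies outside `Q`, so the exchange lemmas apply to the edge `uw` of
    -- `Outer`.
    neighbour-partner : ∀ {u w} → F u → E K u w → m w ≢ w × F (m w)
    neighbour-partner {u} {w} u-free@(_ , u∉Q , u-miss) e = mw≢w ,
      E⇒V K (E-sym K (proj₁ (M.edge mw≢w))) , proj₂ (proj₂ (M.edge mw≢w)) ,
      partner-missable (Outer-sym K Q?) outer-proper M u-miss e′
      where
      e′ : R u w
      e′ = e , u∉Q , λ w∈Q → isolated u-free w∈Q e
      mw≢w : m w ≢ w
      mw≢w = neighbour-covered (Outer-sym K Q?) outer-proper M u-miss e′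

  -- A neighbour of a free vertex is covered by every maximum matching, so it is not free itself.
  free-independent : ∀ {u v} → F u → F v → ¬ E K u v
  free-independent u-free (_ , _ , m , M , mv≡v) e = proj₁ (neighbour-partner M u-free e) mv≡v

  module _ (free? : Pred.Decidable F) where

    NearFree : Pred (Fin n) 0ℓ
    NearFree w = ∃[ u ] F u × E K u w

    nearFree? : Pred.Decidable NearFree
    nearFree? w = any? λ u → free? u ×-dec E? K u w

    -- The free vertices together with one colour class of the perfectly matched
    -- rest; the two choices of the class have only the free vertices in common.
    Side : Bool → Pred (Fin n) 0ℓ
    Side b v = v ∈ V K × (F v ⊎ (¬ NearFree v × ¬ r.Unmatched v × c v ≡ b))

    side? : ∀ b → Pred.Decidable (Side b)
    side? b v = (v ∈? V K) ×-dec
      (free? v ⊎-dec (¬? (nearFree? v) ×-dec ¬? (r.unmatched? v) ×-dec (c v Bool.≟ b)))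

    side : Bool → Subset n
    side b = comprehension (side? b)

    free⇒side : ∀ {b v} → F v → v ∈ side b
    free⇒side {b} v-free = ∈-comprehension⁺ (side? b) (proj₁ v-free , inj₁ v-free)

    side⇒free : ∀ {b v} → v ∈ side b → c v ≢ b → F v
    side⇒free {b} v∈ c≢b with ∈-comprehension⁻ (side? b) v∈
    ... | _ , inj₁ v-free       = v-free
    ... | _ , inj₂ (_ , _ , c≡b) = contradiction c≡b c≢b

    side-independent : ∀ b → Independent K (side b)
    side-independent b = proj₁ ∘ ∈-comprehension⁻ (side? b)
      , λ u∈ v∈ → nonadjacent (∈-comprehension⁻ (side? b) u∈) (∈-comprehension⁻ (side? b) v∈)
      where
      nonadjacent : ∀ {u v} → Side b u → Side b v → ¬ E K u v
      nonadjacent (_ , inj₁ u-free) (_ , inj₁ v-free) e = free-independent u-free v-free e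
      nonadjacent (_ , inj₁ u-free) (_ , inj₂ (v∉N , _)) e = v∉N (_ , u-free , e)
      nonadjacent (_ , inj₂ (u∉N , _)) (_ , inj₁ v-free) e = u∉N (_ , v-free , E-sym K e)
      nonadjacent (_ , inj₂ (_ , u-m , cu)) (_ , inj₂ (_ , v-m , cv)) e =
        c-proper e u-m v-m (trans cu (sym cv))

    freeSet : Subset n
    freeSet = comprehension free?

    freeSet-independent : Independent K freeSet
    freeSet-independent = proj₁ ∘ ∈-comprehension⁻ free?
      , λ u∈ v∈ → free-independent (∈-comprehension⁻ free? u∈) (∈-comprehension⁻ free? v∈)

    module _ {m} (M : Maximum R m) where

      private module M = Maximum M

      Exposed : Pred (Fin n) 0ℓ
      Exposed v = v ∈ V K × ¬ Q v × m v ≡ v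

      exposed? : Pred.Decidable Exposed
      exposed? v = (v ∈? V K) ×-dec ¬? (Q? v) ×-dec (m v ≟ v)

      exposed⇒free : ∀ {v} → Exposed v → F v
      exposed⇒free (v∈V , v∉Q , mv≡v) = v∈V , v∉Q , m , M , mv≡v

      h : ℕ
      h = sum λ v → 𝟙 (exposed? v)

      h∩ : Subset n → ℕ
      h∩ T = sum λ v → 𝟙 ((v ∈? T) ×-dec exposed? v)

      h∩≤h : ∀ T → h∩ T ≤ h
      h∩≤h T = sum-mono λ v → 𝟙-mono ((v ∈? T) ×-dec exposed? v) (exposed? v) proj₂

      h≤h∩⇒exposed⊆ : ∀ T → h ≤ h∩ T → ∀ {v} → Exposed v → v ∈ T
      h≤h∩⇒exposed⊆ T h≤ {v} v-exp
        with (v ∈? T) ×-dec exposed? v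
           | sum-tight (λ v → 𝟙-mono ((v ∈? T) ×-dec exposed? v) (exposed? v) proj₂) h≤ v
      ... | yes (v∈T , _) | _ = v∈T
      ... | no _          | l = contradiction (subst (_≤ 0) (𝟙-yes (exposed? v) v-exp) l) λ ()

      module _ {s} (s-mate : InnerMate K Q? δ s) where

        private
          module s = InnerMate s-mate
          f = combine s-mate M.mate
          module f = Mate (combine-mate s-mate M.mate)

        fixed : ∀ {v} → f v ≡ v → ¬ s.Unmatched v → v ∈ V K → Exposed v
        fixed {v} fv≡v v-m v∈V = v∈V , v∉Q , trans (sym (combine-out s-mate M.mate v∉Q)) fv≡v
          where
          v∉Q : ¬ Q v
          v∉Q v∈Q = v-m (v∈Q , trans (sym (combine-in s-mate M.mate v∈Q)) fv≡v)

        module _ {T : Subset n} (T-ind : Independent K T) (avoids : ∀ {v} → s.Unmatched v → v ∉ T) where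

          -- Counts, for each `v`, whether `v` and its partner `f v` lie in `T`. Both do only if `v`
          -- is exposed, and neither does if `s` leaves `v` unmatched.
          independent-bound : ∣ T ∣ + ∣ T ∣ + δ ≤ order K + h∩ T
          independent-bound = begin
            ∣ T ∣ + ∣ T ∣ + δ
              ≡⟨ cong₂ _+_ (cong₂ _+_ (∣∣≡sum T) (trans (∣∣≡sum T) (sym (sum-involution (λ v → 𝟙 (v ∈? T)) f.involutive))))
                         (sym s.deficiency) ⟩
            sum (λ v → 𝟙 (v ∈? T)) + sum (λ v → 𝟙 (f v ∈? T)) + sum (λ v → 𝟙 (s.unmatched? v))
              ≡⟨ cong (_+ sum (λ v → 𝟙 (s.unmatched? v))) (∑-distrib-+ (λ v → 𝟙 (v ∈? T)) _) ⟨
            sum (λ v → 𝟙 (v ∈? T) + 𝟙 (f v ∈? T)) + sum (λ v → 𝟙 (s.unmatched? v))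
              ≡⟨ ∑-distrib-+ (λ v → 𝟙 (v ∈? T) + 𝟙 (f v ∈? T)) _ ⟨
            sum (λ v → 𝟙 (v ∈? T) + 𝟙 (f v ∈? T) + 𝟙 (s.unmatched? v))
              ≤⟨ sum-mono pointwise ⟩
            sum (λ v → 𝟙 (v ∈? V K) + 𝟙 ((v ∈? T) ×-dec exposed? v))
              ≡⟨ ∑-distrib-+ (λ v → 𝟙 (v ∈? V K)) _ ⟩
            sum (λ v → 𝟙 (v ∈? V K)) + h∩ T
              ≡⟨ cong (_+ h∩ T) (∣∣≡sum (V K)) ⟨
            order K + h∩ T ∎
            where
            open ℕ.≤-Reasoning
            pointwise : ∀ v → 𝟙 (v ∈? T) + 𝟙 (f v ∈? T) + 𝟙 (s.unmatched? v) ≤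
                              𝟙 (v ∈? V K) + 𝟙 ((v ∈? T) ×-dec exposed? v)
            pointwise v with s.unmatched? v
            ... | yes u@(v∈Q , sv≡v)
              rewrite 𝟙-no (v ∈? T) (avoids u)
                    | 𝟙-no (f v ∈? T) (avoids u ∘ subst (_∈ T) (trans (combine-in s-mate M.mate v∈Q) sv≡v))
                    | 𝟙-yes (v ∈? V K) (Q⊆V v∈Q) = s≤s z≤n
            ... | no v-m with v ∈? T | f v ∈? T
            ...   | no _    | no _ = z≤n
            ...   | yes v∈T | no _ rewrite 𝟙-yes (v ∈? V K) (proj₁ T-ind v∈T) = s≤s z≤n
            ...   | no v∉T  | yes fv∈T
              rewrite 𝟙-yes (v ∈? V K) (E⇒V K (f.edge λ fv≡v → v∉T (subst (_∈ T) fv≡v fv∈T))) = s≤s z≤n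
            ...   | yes v∈T | yes fv∈T
              rewrite 𝟙-yes (v ∈? V K) (proj₁ T-ind v∈T)
                    | 𝟙-yes (yes v∈T ×-dec exposed? v) (v∈T , fixed (decidable-stable (f v ≟ v) λ fv≢v →
                             proj₂ T-ind v∈T fv∈T (f.edge fv≢v)) v-m (proj₁ T-ind v∈T)) = s≤s (s≤s z≤n)

          -- The involution `f` sends the vertices of `T` that it moves into the neighbourhood of
          -- `T`; those it fixes are exposed, since the leftover vertices of `s` avoid `T`.
          neighbourhood-bound : ∣ T ∣ ≤ ∣ N K T ∣ + h∩ T
          neighbourhood-bound = begin
            ∣ T ∣                    ≡⟨ ∣∣≡sum T ⟩
            sum (λ v → 𝟙 (v ∈? T))   ≤⟨ sum-mono pointwise ⟩
            sum (λ v → 𝟙 (f v ∈? N K T) + 𝟙 ((v ∈? T) ×-dec exposed? v))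
              ≡⟨ ∑-distrib-+ (λ v → 𝟙 (f v ∈? N K T)) _ ⟩
            sum (λ v → 𝟙 (f v ∈? N K T)) + h∩ T
              ≡⟨ cong (_+ h∩ T) (trans (sum-involution (λ v → 𝟙 (v ∈? N K T)) f.involutive) (sym (∣∣≡sum (N K T)))) ⟩
            ∣ N K T ∣ + h∩ T ∎
            where
            open ℕ.≤-Reasoning
            pointwise : ∀ v → 𝟙 (v ∈? T) ≤ 𝟙 (f v ∈? N K T) + 𝟙 ((v ∈? T) ×-dec exposed? v)
            pointwise v with v ∈? T
            ... | no _ = z≤n
            ... | yes v∈T with f v ≟ v
            ...   | yes fv≡v
              rewrite 𝟙-yes (yes v∈T ×-dec exposed? v) (v∈T , fixed fv≡v (λ u → avoids u v∈T) (proj₁ T-ind v∈T)) =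
              ℕ.m≤n+m 1 _
            ...   | no fv≢v rewrite 𝟙-yes (f v ∈? N K T) (∈-N⁺ K v∈T (f.edge fv≢v)) = s≤s z≤n

      -- The matching `m` maps neighbours of free vertices to free vertices. It fixes the exposed
      -- vertices, which are free and, being fixed, are not such neighbours.
      freeSet-bound : ∣ N K freeSet ∣ + h ≤ ∣ freeSet ∣
      freeSet-bound = begin
        ∣ N K freeSet ∣ + h                                        ≡⟨ cong (_+ h) (∣∣≡sum (N K freeSet)) ⟩
        sum (λ w → 𝟙 (w ∈? N K freeSet)) + h                       ≡⟨ ∑-distrib-+ (λ w → 𝟙 (w ∈? N K freeSet)) _ ⟨
        sum (λ w → 𝟙 (w ∈? N K freeSet) + 𝟙 (exposed? w))          ≤⟨ sum-mono pointwise ⟩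
        sum (λ w → 𝟙 (m w ∈? freeSet))                             ≡⟨ sum-involution (λ w → 𝟙 (w ∈? freeSet)) M.involutive ⟩
        sum (λ w → 𝟙 (w ∈? freeSet))                               ≡⟨ ∣∣≡sum freeSet ⟨
        ∣ freeSet ∣                                                 ∎
        where
        open ℕ.≤-Reasoning
        pointwise : ∀ w → 𝟙 (w ∈? N K freeSet) + 𝟙 (exposed? w) ≤ 𝟙 (m w ∈? freeSet)
        pointwise w with w ∈? N K freeSet
        ... | yes w∈N with ∈-N⁻ K w∈N
        ...   | u , u∈D , e with neighbour-partner M (∈-comprehension⁻ free? u∈D) e
        ...     | mw≢w , mw-free
          rewrite 𝟙-no (exposed? w) (mw≢w ∘ proj₂ ∘ proj₂)
                | 𝟙-yes (m w ∈? freeSet) (∈-comprehension⁺ free? mw-free) = ≤-refl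
        pointwise w | no _ = 𝟙-mono (exposed? w) (m w ∈? freeSet)
          λ w-exp → ∈-comprehension⁺ free? (subst F (sym (proj₂ (proj₂ w-exp))) (exposed⇒free w-exp))

      private
        f = combine r-mate M.mate
        module f = Mate (combine-mate r-mate M.mate)

      -- If `f v` is not free, then neither `v` nor `f v` is adjacent to a free vertex, because
      -- partners of such neighbours are free. So only its colour keeps `v` out of the side, and
      -- `f v` has the other colour.
      side-paired : ∀ b {v} → v ∈ V K → ¬ r.Unmatched v → v ∉ side b → f v ∈ side b
      side-paired b {v} v∈V v-m v∉S with f v ≟ v
      ... | yes fv≡v = contradiction (free⇒side (exposed⇒free (fixed r-mate fv≡v v-m v∈V))) v∉S
      ... | no fv≢v with free? (f v)
      ...   | yes fv-free = free⇒side fv-free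
      ...   | no ¬fv-free = ∈-comprehension⁺ (side? b) (E⇒V K (E-sym K e) , inj₂ (¬fv-near , fv-m , colour))
        where
        e : E K v (f v)
        e = f.edge fv≢v
        near⇒free : ∀ {w} → NearFree w → F (f w)
        near⇒free {w} (u , u-free , e′) = subst F
          (sym (combine-out r-mate M.mate λ w∈Q → isolated u-free w∈Q e′)) (proj₂ (neighbour-partner M u-free e′))
        ¬fv-near : ¬ NearFree (f v)
        ¬fv-near near = v∉S (free⇒side (subst F (f.involutive v) (near⇒free near)))
        fv-m : ¬ r.Unmatched (f v)
        fv-m (fv∈Q , rfv≡fv) = fv≢v (trans (sym rfv≡fv)
          (trans (sym (combine-in r-mate M.mate fv∈Q)) (f.involutive v)))
        ¬v-near : ¬ NearFree v
        ¬v-near near = ¬fv-free (near⇒free near)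
        cv≢b : c v ≢ b
        cv≢b cv≡b = v∉S (∈-comprehension⁺ (side? b) (v∈V , inj₂ (¬v-near , v-m , cv≡b)))
        colour : c (f v) ≡ b
        colour = trans (Bool.¬-not (c-proper e v-m fv-m ∘ sym)) (sym (Bool.¬-not (cv≢b ∘ sym)))

      -- Reverses the count of `independent-bound`: an exposed vertex is its own partner and lies in
      -- the side, and of any other matched vertex and its partner at least one does.
      side-bound : ∀ b → order K + h ≤ ∣ side b ∣ + ∣ side b ∣ + δ
      side-bound b = begin
        order K + h
          ≡⟨ cong (_+ h) (∣∣≡sum (V K)) ⟩
        sum (λ v → 𝟙 (v ∈? V K)) + h
          ≡⟨ ∑-distrib-+ (λ v → 𝟙 (v ∈? V K)) _ ⟨
        sum (λ v → 𝟙 (v ∈? V K) + 𝟙 (exposed? v))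
          ≤⟨ sum-mono pointwise ⟩
        sum (λ v → 𝟙 (v ∈? S) + 𝟙 (f v ∈? S) + 𝟙 (r.unmatched? v))
          ≡⟨ ∑-distrib-+ (λ v → 𝟙 (v ∈? S) + 𝟙 (f v ∈? S)) _ ⟩
        sum (λ v → 𝟙 (v ∈? S) + 𝟙 (f v ∈? S)) + sum (λ v → 𝟙 (r.unmatched? v))
          ≡⟨ cong (_+ sum (λ v → 𝟙 (r.unmatched? v))) (∑-distrib-+ (λ v → 𝟙 (v ∈? S)) _) ⟩
        sum (λ v → 𝟙 (v ∈? S)) + sum (λ v → 𝟙 (f v ∈? S)) + sum (λ v → 𝟙 (r.unmatched? v))
          ≡⟨ cong₂ _+_ (cong₂ _+_ (∣∣≡sum S) (trans (∣∣≡sum S) (sym (sum-involution (λ v → 𝟙 (v ∈? S)) f.involutive))))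
                         (sym r.deficiency) ⟨
        ∣ S ∣ + ∣ S ∣ + δ ∎
        where
        open ℕ.≤-Reasoning
        S = side b
        pointwise : ∀ v → 𝟙 (v ∈? V K) + 𝟙 (exposed? v) ≤ 𝟙 (v ∈? S) + 𝟙 (f v ∈? S) + 𝟙 (r.unmatched? v)
        pointwise v with exposed? v
        ... | yes v-exp@(v∈V , v∉Q , mv≡v)
          rewrite 𝟙-yes (v ∈? V K) v∈V
                | trans (combine-out r-mate M.mate v∉Q) mv≡v
                | 𝟙-yes (v ∈? S) (free⇒side (exposed⇒free v-exp)) = s≤s (s≤s z≤n)
        ... | no _ with v ∈? V K
        ...   | no _ = z≤n
        ...   | yes v∈V with r.unmatched? v
        ...     | yes _ = ℕ.m≤n+m 1 _
        ...     | no v-m with v ∈? S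
        ...       | yes _ = s≤s z≤n
        ...       | no v∉S rewrite 𝟙-yes (f v ∈? S) (side-paired b v∈V v-m v∉S) = s≤s z≤n

      side-maximum : ∀ b → MaximumIndependent K (side b)
      side-maximum b = side-independent b , λ T T-ind → decidable-stable (∣ T ∣ ℕ.≤? ∣ side b ∣) λ ¬≤ →
        inner T-ind λ (s , s-mate , avoids) → ¬≤ (2*-cancel-≤ (ℕ.+-cancelʳ-≤ δ _ _ (begin
          ∣ T ∣ + ∣ T ∣ + δ             ≤⟨ independent-bound s-mate T-ind avoids ⟩
          order K + h∩ T                ≤⟨ ℕ.+-monoʳ-≤ (order K) (h∩≤h T) ⟩
          order K + h                   ≤⟨ side-bound b ⟩
          ∣ side b ∣ + ∣ side b ∣ + δ  ∎)))
        where open ℕ.≤-Reasoning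

      -- A maximum `T` is at least as large as a side. This makes `independent-bound` tight, so `T`
      -- contains every exposed vertex.
      exposed⊆maximum : ∀ {T} → MaximumIndependent K T → ∀ {v} → Exposed v → v ∈ T
      exposed⊆maximum {T} (T-ind , T-max) {v} v-exp = decidable-stable (v ∈? T) λ v∉T →
        inner T-ind λ (s , s-mate , avoids) → v∉T (h≤h∩⇒exposed⊆ T (ℕ.+-cancelˡ-≤ (order K) _ _ (begin
          order K + h                   ≤⟨ side-bound true ⟩
          ∣ S ∣ + ∣ S ∣ + δ             ≤⟨ ℕ.+-monoˡ-≤ δ (+-mono-≤ ∣S∣≤∣T∣ ∣S∣≤∣T∣) ⟩
          ∣ T ∣ + ∣ T ∣ + δ             ≤⟨ independent-bound s-mate T-ind avoids ⟩
          order K + h∩ T                ∎)) v-exp)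
        where
        open ℕ.≤-Reasoning
        S = side true
        ∣S∣≤∣T∣ = T-max S (side-independent true)

      -- The difference of an independent set is at most `h` by `neighbourhood-bound`, and that of
      -- `freeSet` is at least `h`.
      freeSet-critical : CriticalIndependent K freeSet
      freeSet-critical = freeSet-independent , λ I I-ind → decidable-stable (d K I ℤ.≤? d K freeSet) λ ¬≤ →
        inner I-ind λ (s , s-mate , avoids) → ¬≤ (⊖-≤⁺ (∣ I ∣) (∣ N K I ∣) (∣ freeSet ∣) (∣ N K freeSet ∣) (begin
          ∣ I ∣ + ∣ N K freeSet ∣                  ≤⟨ ℕ.+-monoˡ-≤ ∣ N K freeSet ∣ (neighbourhood-bound s-mate I-ind avoids) ⟩
          ∣ N K I ∣ + h∩ I + ∣ N K freeSet ∣       ≤⟨ ℕ.+-monoˡ-≤ ∣ N K freeSet ∣ (ℕ.+-monoʳ-≤ ∣ N K I ∣ (h∩≤h I)) ⟩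
          ∣ N K I ∣ + h + ∣ N K freeSet ∣          ≡⟨ trans (+-assoc (∣ N K I ∣) h _) (cong (∣ N K I ∣ +_) (+-comm h _)) ⟩
          ∣ N K I ∣ + (∣ N K freeSet ∣ + h)        ≤⟨ ℕ.+-monoʳ-≤ ∣ N K I ∣ freeSet-bound ⟩
          ∣ N K I ∣ + ∣ freeSet ∣                  ≡⟨ +-comm ∣ N K I ∣ _ ⟩
          ∣ freeSet ∣ + ∣ N K I ∣                  ∎))
        where open ℕ.≤-Reasoning

      exposed⊆critical : ∀ {A} → CriticalIndependent K A → ∀ {v} → Exposed v → v ∈ A
      exposed⊆critical {A} (A-ind , A-crit) {v} v-exp = decidable-stable (v ∈? A) λ v∉A →
        inner A-ind λ (s , s-mate , avoids) → v∉A (h≤h∩⇒exposed⊆ A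
          (ℕ.+-cancelˡ-≤ (∣ N K freeSet ∣ + ∣ N K A ∣) _ _ (begin
          ∣ N K freeSet ∣ + ∣ N K A ∣ + h          ≡⟨ swapʳ (∣ N K freeSet ∣) _ h ⟩
          ∣ N K freeSet ∣ + h + ∣ N K A ∣          ≤⟨ ℕ.+-monoˡ-≤ ∣ N K A ∣ freeSet-bound ⟩
          ∣ freeSet ∣ + ∣ N K A ∣                  ≤⟨ ⊖-≤⁻ (∣ freeSet ∣) (∣ N K freeSet ∣) (∣ A ∣) (∣ N K A ∣)
                                                         (A-crit freeSet freeSet-independent) ⟩
          ∣ A ∣ + ∣ N K freeSet ∣                  ≤⟨ ℕ.+-monoˡ-≤ ∣ N K freeSet ∣ (neighbourhood-bound s-mate A-ind avoids) ⟩
          ∣ N K A ∣ + h∩ A + ∣ N K freeSet ∣       ≡⟨ +-comm _ ∣ N K freeSet ∣ ⟩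
          ∣ N K freeSet ∣ + (∣ N K A ∣ + h∩ A)     ≡⟨ +-assoc ∣ N K freeSet ∣ _ _ ⟨
          ∣ N K freeSet ∣ + ∣ N K A ∣ + h∩ A       ∎)) v-exp)
        where
        open ℕ.≤-Reasoning
        swapʳ : ∀ a b c → a + b + c ≡ a + c + b
        swapʳ a b c = trans (+-assoc a b c) (trans (cong (a +_) (+-comm b c)) (sym (+-assoc a c b)))

  -- The maximum matching that witnesses freeness misses `v`, so `v` is exposed with respect to it.
  free⇒core : ∀ {v} → F v → core K v
  free⇒core {v} (v∈V , v∉Q , m , M , mv≡v) S S-max = decidable-stable (v ∈? S) λ v∉S →
    ¬¬-decidable F λ free? → v∉S (exposed⊆maximum free? M S-max (v∈V , v∉Q , mv≡v))

  free⇒ker : ∀ {v} → F v → ker K v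
  free⇒ker {v} (v∈V , v∉Q , m , M , mv≡v) A A-crit = decidable-stable (v ∈? A) λ v∉A →
    ¬¬-decidable F λ free? → v∉A (exposed⊆critical free? M A-crit (v∈V , v∉Q , mv≡v))

  core⇒free : ∀ {v} → core K v → ¬ ¬ F v
  core⇒free {v} v∈core ¬free = ¬¬-maximum R λ (m , M) → ¬¬-decidable F λ free? →
    -- The side of the colour opposite to that of `v` can contain `v` only as a free vertex.
    ¬free (side⇒free free? (v∈core _ (side-maximum free? M (not (c v)))) (Bool.not-¬ refl))

  ker⇒free : ∀ {v} → ker K v → ¬ ¬ F v
  ker⇒free v∈ker ¬free = ¬¬-maximum R λ (m , M) → ¬¬-decidable F λ free? →
    ¬free (∈-comprehension⁻ free? (v∈ker _ (freeSet-critical free? M)))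

-- Bipartite graphs as the case of empty `Q`

none? : ∀ {n} → Pred.Decidable {A = Fin n} (λ _ → ⊥)
none? _ = no id

bipartite : ∀ {n} (K : Graph n) {c : Fin n → Bool} → Colouring (E K) c → Setting K none? 0
bipartite {n} K c-proper = record
  { r-mate   = id-inner
  ; Q⊆V      = λ ()
  ; c-proper = λ e _ _ → c-proper e
  ; isolated = λ _ ()
  ; inner    = λ _ k → k (id , id-inner , λ u → ⊥-elim (proj₁ u)) }
  where
  id-inner : InnerMate K none? 0 id
  id-inner = record { mate = id-mate ; outside = λ _ → refl
                    ; deficiency = sum-0 {n} λ v → 𝟙-no (none? v ×-dec (v ≟ v)) proj₁ }

-- Almost bipartite graphs that are not Kőnig–Egerváry

module NonKE {n} (G : Graph n) (ab : AlmostBipartite G) (¬KE : ¬ KőnigEgerváry G) where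

  open AlmostBipartite ab
  open CyclicOrder C
  open Cut ab

  H : Rel (Fin n) 0ℓ
  H = Outer G (vc? C)

  FreeG : Pred (Fin n) 0ℓ
  FreeG = Free G (vc? C)

  module AtEdge (i : ℕ) where

    y z : Fin n
    y = p i
    z = p (suc i)

    yz : E G y z
    yz = EC⇒E (p-EC i)

    y≢z : y ≢ z
    y≢z y≡z = E-irrefl G (subst (E G y) (sym y≡z) yz)

    setting : Setting (cut i) none? 0
    setting = bipartite (cut i) (c-proper i)

    B : Rel (Fin n) 0ℓ
    B = Outer (cut i) none?

    B⊆E : ∀ {u v} → B u v → E G u v
    B⊆E (e , _) = proj₁ e

    B-sym : Symmetric B
    B-sym = Outer-sym (cut i) none?

    B-proper : Colouring B (c i)
    B-proper = Optimal.outer-proper setting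

    outside⇒B : ∀ {u v} → E G u v → ¬ EC C u v → B u v
    outside⇒B e ¬ec = ¬EC⇒cut i e ¬ec , id , id

    independent⁺ : ∀ {S x} → Independent (cut i) S → (x ≡ y ⊎ x ≡ z) → x ∉ S → Independent G S
    independent⁺ {S} {x} (S⊆V , S-ind) x≡ x∉S = S⊆V , nonadjacent
      where
      nonadjacent : ∀ {u v} → u ∈ S → v ∈ S → ¬ E G u v
      nonadjacent u∈S v∈S e = S-ind u∈S v∈S (e , λ same → x∉S (end x≡ same u∈S v∈S))
        where
        end : ∀ {x u v} → (x ≡ y ⊎ x ≡ z) → SameEdge (u , v) (y , z) → u ∈ S → v ∈ S → x ∈ S
        end (inj₁ refl) (inj₁ refl) u∈ v∈ = u∈
        end (inj₁ refl) (inj₂ refl) u∈ v∈ = v∈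
        end (inj₂ refl) (inj₁ refl) u∈ v∈ = v∈
        end (inj₂ refl) (inj₂ refl) u∈ v∈ = u∈

    -- Otherwise an optimal independent set of the cut graph avoids x, hence is
    -- independent in G.
    end-free : ∀ {x} → (x ≡ y ⊎ x ≡ z) → ¬ ¬ Free (cut i) none? x
    end-free {x} x≡ ¬free = ¬¬-maximum B λ (m , M) → ¬¬-decidable (Free (cut i) none?) λ free? →
      ¬KE (könig-egerváry G (mate-mono B⊆E (Maximum.mate M))
        (independent⁺ (Optimal.side-independent setting free? b) x≡ λ x∈ →
          ¬free (Optimal.side⇒free setting free? x∈ (Bool.not-¬ (colour x≡))))
        λ v∈V v∉S → Optimal.side-paired setting free? M b v∈V proj₁ v∉S)
      where
      -- The ends `y` and `z` have the same colour, so the opposite side contains either of them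
      -- only if it is free.
      b = not (c i y)
      colour : ∀ {x} → (x ≡ y ⊎ x ≡ z) → c i x ≡ c i y
      colour (inj₁ refl) = refl
      colour (inj₂ refl) = sym (c-ends i)

    module TwoMatchings {a b} (A : Maximum B a) (A-y : a y ≡ y) (B′ : Maximum B b) (B-z : b z ≡ z) where

      private
        module A = Maximum A
        module B′ = Maximum B′

      Alternating : Rel (Fin n) 0ℓ
      Alternating u v = v ≡ a u ⊎ v ≡ b u

      alternating? : Pred.Decidable (Star Alternating y)
      alternating? = star? Alternating (λ u v → (v ≟ a u) ⊎-dec (v ≟ b u)) y

      -- Otherwise exchanging the matchings on the component of y yields a
      -- maximum matching of the cut graph to which yz can be added.
      connected : ¬ ¬ Star Alternating y z
      connected z∉O = end-free (inj₁ refl) λ y-free → end-free (inj₂ refl) λ z-free →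
        ¬¬-decidable (Free (cut i) none?) λ free? → ¬KE (witness free? y-free z-free)
        where
        a-closed : ∀ {v} → Star Alternating y v → Star Alternating y (a v)
        a-closed o = o ◅◅ (inj₁ refl ◅ ε)
        b-closed : ∀ {v} → Star Alternating y v → Star Alternating y (b v)
        b-closed o = o ◅◅ (inj₂ refl ◅ ε)
        s : Fin n → Fin n
        s = splice alternating? a b
        S : Maximum B s
        S = maximum-≤ B′ (splice-mate alternating? A.mate B′.mate a-closed b-closed)
          (splice-≤ʳ alternating? (A.minimal _ (splice-mate alternating? B′.mate A.mate b-closed a-closed)))
        s-y : s y ≡ y
        s-y = trans (splice-in alternating? a b ε) A-y
        s-z : s z ≡ z
        s-z = trans (splice-out alternating? a b z∉O) B-z
        witness : Pred.Decidable (Free (cut i) none?) → Free (cut i) none? y → Free (cut i) none? z → KőnigEgerváry G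
        witness free? y-free z-free = könig-egerváry G
          (join-mate y z s (mate-mono B⊆E (Maximum.mate S)) (E-sym G) yz y≢z s-y s-z)
          (independent⁺ (proj₁ side-ind ∘ T⊆T₀ , λ u∈ v∈ → proj₂ side-ind (T⊆T₀ u∈) (T⊆T₀ v∈))
                        (inj₁ refl) λ y∈T → proj₂ (∈-comprehension⁻ T? y∈T) refl)
          paired
          where
          -- The side contains `y` and `z`, as both are free. Dropping `y` makes it independent in
          -- `G`, and the added edge `yz` pairs `y` with `z`.
          T₀ = Optimal.side setting free? true
          side-ind = Optimal.side-independent setting free? true
          T? : Pred.Decidable (λ v → v ∈ T₀ × v ≢ y)
          T? v = (v ∈? T₀) ×-dec ¬? (v ≟ y)
          T⊆T₀ : ∀ {v} → v ∈ comprehension T? → v ∈ T₀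
          T⊆T₀ = proj₁ ∘ ∈-comprehension⁻ T?
          paired : ∀ {v} → v ∈ V G → v ∉ comprehension T? → join y z s v ∈ comprehension T?
          paired {v} v∈V v∉T = cases (v ≟ y)
            where
            cases : Dec (v ≡ y) → join y z s v ∈ comprehension T?
            cases (yes refl) = subst (_∈ comprehension T?) (sym (join-x y z s))
              (∈-comprehension⁺ T? (Optimal.free⇒side setting free? z-free , y≢z ∘ sym))
            cases (no v≢y) = subst (_∈ comprehension T?) (sym (join-other y z s v≢y v≢z))
                (∈-comprehension⁺ T? (Optimal.side-paired setting free? S true v∈V proj₁ v∉side , sv≢y))
              where
              v∉side : v ∉ T₀
              v∉side v∈ = v∉T (∈-comprehension⁺ T? (v∈ , v≢y))
              v≢z : v ≢ z
              v≢z refl = v∉side (Optimal.free⇒side setting free? z-free)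
              sv≢y : s v ≢ y
              sv≢y sv≡y = v≢y (trans (sym (Maximum.involutive S v)) (trans (cong s sv≡y) s-y))

      Covered : Rel (Fin n) 0ℓ
      Covered u v = a u ≡ v ⊎ b u ≡ v ⊎ SameEdge (u , v) (y , z)

      -- a, b and yz contain a closed walk of odd length, hence all edges of C.
      cycle-covered : ∀ {u v} → EC C u v → Covered u v
      cycle-covered {u} {v} uv = decidable-stable (covered? u v) λ ¬uv →
        connected λ y~z → uncolourable y~z
          (two-colouring ab {R} R? R-sym proj₁ λ EC⊆R → ¬uv (proj₂ (EC⊆R uv)))
        where
        covered? : Decidable Covered
        covered? u v = (a u ≟ v) ⊎-dec (b u ≟ v) ⊎-dec
          ≡-dec _≟_ _≟_ (u , v) (y , z) ⊎-dec ≡-dec _≟_ _≟_ (u , v) (z , y)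
        R : Rel (Fin n) 0ℓ
        R u v = E G u v × Covered u v
        R? : Decidable R
        R? u v = E? G u v ×-dec covered? u v
        R-sym : Symmetric R
        R-sym (e , inj₁ refl) = E-sym G e , inj₁ (A.involutive _)
        R-sym (e , inj₂ (inj₁ refl)) = E-sym G e , inj₂ (inj₁ (B′.involutive _))
        R-sym (e , inj₂ (inj₂ (inj₁ refl))) = E-sym G e , inj₂ (inj₂ (inj₂ refl))
        R-sym (e , inj₂ (inj₂ (inj₂ refl))) = E-sym G e , inj₂ (inj₂ (inj₁ refl))
        -- Alternating steps are properly coloured by `c′` and by `c i`, so the exclusive or agrees
        -- at `y` and `z`. As `c i` agrees there, `c′` would give the ends of the edge `yz` the same
        -- colour.
        uncolourable : Star Alternating y z → ¬ (∃[ c′ ] Colouring R c′)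
        uncolourable y~z (c′ , c′-proper) = c′-proper (yz , inj₂ (inj₂ (inj₁ refl)))
          (xor-cancelʳ (c i z) (subst (λ x → c′ y xor x ≡ c′ z xor c i z) (c-ends i)
            (xor-invariant {c = c′} {c i} step y~z)))
          where
          step : ∀ {u v} → Alternating u v → u ≡ v ⊎ (c′ u ≢ c′ v × c i u ≢ c i v)
          step {u} {v} u-v with v ≟ u
          ... | yes v≡u = inj₁ (sym v≡u)
          step {u} (inj₁ refl) | no ≢u = inj₂ (c′-proper (B⊆E (A.edge ≢u) , inj₁ refl) , B-proper (A.edge ≢u))
          step {u} (inj₂ refl) | no ≢u = inj₂ (c′-proper (B⊆E (B′.edge ≢u) , inj₂ (inj₁ refl)) , B-proper (B′.edge ≢u))

      -- Both edges of `C` at `v` are covered. If `v` is not `z`, neither is `yz` and `b` covers at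
      -- most one of them, so `a` covers one. At `z`, which `b` misses, the edge other than `yz` is
      -- left to `a`.
      cycle-matched : ∀ {v} → VC C v → v ≢ y → VC C (a v) × a v ≢ v
      cycle-matched v∈C = from-y (VC⇒p-from i v∈C)
        where
        next≢ : ∀ j → p (suc j) ≢ p j
        next≢ j eq = E-irrefl G (subst (E G (p j)) eq (EC⇒E (p-EC j)))
        via : ∀ {v} k → a v ≡ p k → p k ≢ v → VC C (a v) × a v ≢ v
        via {v} k eq ≢v = subst (VC C) (sym eq) (p∈VC k) , λ av≡v → ≢v (trans (sym eq) av≡v)
        b-forward : ∀ t → suc (suc t) < L →
                    b (p (suc (suc t) + i)) ≡ p (suc (suc (suc t)) + i) →
                    Covered (p (suc (suc t) + i)) (p (suc t + i)) →
                    VC C (a (p (suc (suc t) + i))) × a (p (suc (suc t) + i)) ≢ p (suc (suc t) + i)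
        b-forward t _   _  (inj₁ eq′) = via (suc t + i) eq′ (next≢ (suc t + i) ∘ sym)
        b-forward t _   eq (inj₂ (inj₁ eq′)) = contradiction
          (trans (sym eq′) (trans eq (cong p (+-comm 2 (suc t + i)))))
          (p-≢ C-odd (suc t + i) z<s (2<L C-odd))
        b-forward t t<L _  (inj₂ (inj₂ same)) = contradiction
          (subst (λ j → SameEdge (p j , p (suc j)) (y , z)) (+-comm (suc t) i) (flip same))
          (p-edges-distinct C-odd i z<s (ℕ.<-trans (ℕ.n<1+n _) t<L))
          where
          flip : ∀ {u v} {e : Fin n × Fin n} → SameEdge (u , v) e → SameEdge (v , u) e
          flip (inj₁ refl) = inj₂ refl
          flip (inj₂ refl) = inj₁ refl
        forward : ∀ t → suc t < L → Covered (p (suc t + i)) (p (suc (suc t) + i)) →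
                  VC C (a (p (suc t + i))) × a (p (suc t + i)) ≢ p (suc t + i)
        forward t       _   (inj₁ eq) = via (suc (suc t) + i) eq (next≢ (suc t + i))
        forward zero    _   (inj₂ (inj₁ eq)) = contradiction (trans (sym eq) B-z) (next≢ (suc i))
        forward (suc t) t<L (inj₂ (inj₁ eq)) = b-forward t t<L eq
          (cycle-covered (EC-sym C {p (suc t + i)} {p (suc (suc t) + i)} (p-EC (suc t + i))))
        forward t       t<L (inj₂ (inj₂ same)) = contradiction
          (subst (λ j → SameEdge (p j , p (suc j)) (y , z)) (+-comm (suc t) i) same)
          (p-edges-distinct C-odd i z<s t<L)
        from-y : ∀ {v} → ∃[ t ] t < L × p (i + t) ≡ v → v ≢ y → VC C (a v) × a v ≢ v
        from-y (zero  , _   , refl) v≢y = contradiction (cong p (+-identityʳ i)) v≢y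
        from-y (suc t , t<L , refl) _   =
          subst (λ j → VC C (a (p j)) × a (p j) ≢ p j) (+-comm (suc t) i)
            (forward t t<L (cycle-covered (p-EC (suc t + i))))

    record CycleMatching : Set where
      field
        {a}       : Fin n → Fin n
        maximum   : Maximum B a
        misses    : a y ≡ y
        matches   : ∀ {v} → VC C v → v ≢ y → VC C (a v) × a v ≢ v

    cycleMatching : ¬ ¬ CycleMatching
    cycleMatching k = end-free (inj₁ refl) λ (_ , _ , a , A , A-y) →
      end-free (inj₂ refl) λ (_ , _ , b , B′ , B-z) →
      k record { maximum = A ; misses = A-y ; matches = TwoMatchings.cycle-matched A A-y B′ B-z }

    module _ (cm : CycleMatching) where

      open CycleMatching cm
      private module A = Maximum maximum

      a-closed : ∀ {v} → VC C v → VC C (a v)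
      a-closed {v} v∈C with v ≟ y
      ... | yes refl = subst (VC C) (sym misses) (p∈VC i)
      ... | no v≢y   = proj₁ (matches v∈C v≢y)

      private
        r : Fin n → Fin n
        r = splice (vc? C) a id

      inner-cycle-unmatched : ∀ {v} → VC C v × r v ≡ v → v ≡ y
      inner-cycle-unmatched {v} (v∈C , rv≡v) = decidable-stable (v ≟ y) λ v≢y →
        proj₂ (matches v∈C v≢y) (trans (sym (splice-in (vc? C) a id v∈C)) rv≡v)

      y-unmatched : VC C y × r y ≡ y
      y-unmatched = p∈VC i , trans (splice-in (vc? C) a id (p∈VC i)) misses

      inner-cycle : InnerMate G (vc? C) 1 r
      inner-cycle = record
        { mate       = splice-mate (vc? C) (mate-mono B⊆E A.mate) id-mate a-closed id
        ; outside    = splice-out (vc? C) a id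
        ; deficiency = trans (sum-cong-≗ λ v → 𝟙-cong (vc? C v ×-dec (r v ≟ v)) (v ≟ y)
                                inner-cycle-unmatched λ { refl → y-unmatched })
                             (sum-𝟙-≟ y) }

      H⊆B : ∀ {u v} → H u v → B u v
      H⊆B (e , u∉C , _) = outside⇒B e (u∉C ∘ EC⇒VC)

      -- A maximum matching of the part outside C together with a is a maximum
      -- matching of the cut graph, so it cannot miss both y and a neighbour of y.
      no-free-neighbour : ∀ {u} → FreeG u → ¬ E G u y
      no-free-neighbour {u} (_ , u∉C , h , Hmax , hu≡u) e =
        maximum-no-join B-sym F (B-sym (outside⇒B e (u∉C ∘ EC⇒VC))) (λ { refl → u∉C (p∈VC i) })
          (trans (splice-in (vc? C) a h (p∈VC i)) misses)
          (trans (splice-out (vc? C) a h u∉C) hu≡u)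
        where
        module Hm = Maximum Hmax
        h-mate : Mate B h
        h-mate = mate-mono H⊆B Hm.mate
        h-fixes : ∀ {v} → VC C v → h v ≡ v
        h-fixes {v} v∈C = decidable-stable (h v ≟ v) λ hv≢v → proj₁ (proj₂ (Hm.edge hv≢v)) v∈C
        h-closed : ∀ {v} → VC C v → VC C (h v)
        h-closed v∈C = subst (VC C) (sym (h-fixes v∈C)) v∈C
        outer-mate : Mate H (splice (vc? C) h a)
        outer-mate = mate-refine swapped λ {v} → edge v (vc? C v)
          where
          swapped : Mate B (splice (vc? C) h a)
          swapped = splice-mate (vc? C) h-mate A.mate h-closed a-closed
          edge : ∀ v → Dec (VC C v) → splice (vc? C) h a v ≢ v → H v (splice (vc? C) h a v)
          edge v (yes v∈C) ≢v = contradiction (trans (splice-in (vc? C) h a v∈C) (h-fixes v∈C)) ≢v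
          edge v (no v∉C)  ≢v = B⊆E (Mate.edge swapped ≢v) , v∉C , λ sv∈C → v∉C
            (subst (VC C) (A.involutive v) (a-closed (subst (VC C) (splice-out (vc? C) h a v∉C) sv∈C)))
        F : Maximum B (splice (vc? C) a h)
        F = maximum-≤ maximum (splice-mate (vc? C) A.mate h-mate a-closed h-closed)
              (splice-≤ˡ (vc? C) (Hm.minimal _ outer-mate))

  open AtEdge using (cycleMatching)

  isolated : ∀ {u v} → FreeG u → VC C v → ¬ E G u v
  isolated u-free v∈C e with VC⇒p v∈C
  ... | i , refl = cycleMatching i λ cm → AtEdge.no-free-neighbour i cm u-free e

  -- The vertices `p 0` and `p 1` are adjacent, so one of them lies outside `T`. The cycle matching
  -- that misses this vertex is chosen.
  inner : ∀ {T} → Independent G T →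
          ¬ ¬ (∃[ s ] Σ[ s-mate ∈ InnerMate G (vc? C) 1 s ] (∀ {v} → InnerMate.Unmatched s-mate v → v ∉ T))
  inner {T} (_ , T-ind) k = avoid (p 0 ∈? T)
    where
    use : ∀ i → p i ∉ T → ⊥
    use i pi∉T = cycleMatching i λ cm → k (_ , AtEdge.inner-cycle i cm , λ u v∈T →
      pi∉T (subst (_∈ T) (AtEdge.inner-cycle-unmatched i cm u) v∈T))
    avoid : Dec (p 0 ∈ T) → ⊥
    avoid (yes p0∈T) = use 1 λ p1∈T → T-ind p0∈T p1∈T (EC⇒E (p-EC 0))
    avoid (no p0∉T)  = use 0 p0∉T

  cycle-setting : AtEdge.CycleMatching 0 → Setting G (vc? C) 1
  cycle-setting cm = record
    { r-mate   = AtEdge.inner-cycle 0 cm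
    ; Q⊆V      = VC⇒V
    ; c        = c 0
    -- The only edge absent from the cut graph has the unmatched vertex `p 0` as an end.
    ; c-proper = λ e u-m v-m → c-proper 0 (e , λ { (inj₁ refl) → u-m (AtEdge.y-unmatched 0 cm)
                                                 ; (inj₂ refl) → v-m (AtEdge.y-unmatched 0 cm) })
    ; isolated = isolated
    ; inner    = inner }

  free⇒core : ∀ {v} → FreeG v → core G v
  free⇒core {v} v-free S S-max = decidable-stable (v ∈? S) λ v∉S →
    cycleMatching 0 λ cm → v∉S (Optimal.free⇒core (cycle-setting cm) v-free S S-max)

  free⇒ker : ∀ {v} → FreeG v → ker G v
  free⇒ker {v} v-free A A-crit = decidable-stable (v ∈? A) λ v∉A →
    cycleMatching 0 λ cm → v∉A (Optimal.free⇒ker (cycle-setting cm) v-free A A-crit)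

  core⇒free : ∀ {v} → core G v → ¬ ¬ FreeG v
  core⇒free v∈ ¬free = cycleMatching 0 λ cm → Optimal.core⇒free (cycle-setting cm) v∈ ¬free

  ker⇒free : ∀ {v} → ker G v → ¬ ¬ FreeG v
  ker⇒free v∈ ¬free = cycleMatching 0 λ cm → Optimal.ker⇒free (cycle-setting cm) v∈ ¬free

-- The branches D_y − y

module Branches {n} (G : Graph n) (ab : AlmostBipartite G) where

  open AlmostBipartite ab
  open CyclicOrder C
  open Cut ab

  G∖C : Graph n
  G∖C = deleteEdges G (EC? C) (EC-sym C)

  private
    clash : ∀ o a b → a xor b ≢ (o xor a) xor (not o xor b)
    clash true  true  true  ()
    clash true  true  false ()
    clash true  false true  ()
    clash true  false false ()
    clash false true  true  ()
    clash false true  false ()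
    clash false false true  ()
    clash false false false ()

  -- Along a walk avoiding C the colourings of all cut graphs change in the same
  -- way, but cutting either of the two edges of C at y gives different parities
  -- of the distance between y and another vertex of C.
  cycle-separated : ∀ {y w} → VC C y → VC C w → Star (E G∖C) y w → w ≡ y
  cycle-separated y∈C w∈C s with VC⇒p y∈C
  ... | i , refl with VC⇒p-from i w∈C
  ... | zero , _ , refl = cong p (+-identityʳ i)
  ... | suc t , t<L , refl = contradiction invariant
        (subst₂ (λ a b → c i (p i) xor c j (p i) ≢ a xor b) (sym cᵢ) (sym cⱼ) (clash (odd t) _ _))
    where
    open Cycle C using (rest)
    -- By periodicity this is the index of the edge of `C` that enters `p i`, while `i` is the index
    -- of the edge that leaves it.
    j = i + length rest
    invariant : c i (p i) xor c j (p i) ≡ c i (p (i + suc t)) xor c j (p (i + suc t))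
    invariant = xor-invariant {c = c i} {c j}
      (λ (e , ¬ec) → inj₂ (c-proper i (¬EC⇒cut i e ¬ec) , c-proper j (¬EC⇒cut j e ¬ec))) s
    cᵢ : c i (p (i + suc t)) ≡ odd t xor c i (p i)
    cᵢ = begin
      c i (p (i + suc t))          ≡⟨ cong (c i ∘ p) (+-suc i t) ⟩
      c i (p (suc i + t))          ≡⟨ c-alternates i t (ℕ.<-trans (ℕ.n<1+n t) t<L) ⟩
      odd t xor c i (p (suc i))    ≡⟨ cong (odd t xor_) (c-ends i) ⟨
      odd t xor c i (p i)          ∎
      where open ≡-Reasoning
    i+L : p (suc j) ≡ p i
    i+L = trans (cong p (sym (+-suc i (length rest)))) (p-period i)
    cⱼ : c j (p (i + suc t)) ≡ not (odd t) xor c j (p i)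
    cⱼ = begin
      c j (p (i + suc t))                ≡⟨ cong (c j) (p-period (i + suc t)) ⟨
      c j (p (i + suc t + L))            ≡⟨ cong (c j ∘ p) rearrange ⟩
      c j (p (suc j + suc t))            ≡⟨ c-alternates j (suc t) t<L ⟩
      not (odd t) xor c j (p (suc j))    ≡⟨ cong (λ v → not (odd t) xor c j v) i+L ⟩
      not (odd t) xor c j (p i)          ∎
      where
      open ≡-Reasoning
      rearrange : i + suc t + L ≡ suc j + suc t
      rearrange = begin
        i + suc t + L     ≡⟨ +-assoc i (suc t) L ⟩
        i + (suc t + L)   ≡⟨ cong (i +_) (+-comm (suc t) L) ⟩
        i + (L + suc t)   ≡⟨ +-assoc i L (suc t) ⟨
        i + L + suc t     ≡⟨ cong (_+ suc t) (+-suc i (length rest)) ⟩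
        suc j + suc t     ∎

  -- The part of the walk before its first vertex on `C` uses no edge of `C`.
  cycle-reached : ∀ {v w} → Star (E G) v w → VC C w → ∃[ y ] VC C y × Star (E G∖C) y v
  cycle-reached {v} s w∈C with vc? C v
  cycle-reached {v} s w∈C | yes v∈C = v , v∈C , ε
  cycle-reached ε w∈C | no v∉C = contradiction w∈C v∉C
  cycle-reached (e ◅ s) w∈C | no v∉C with cycle-reached s w∈C
  ... | y , y∈C , r = y , y∈C , r ◅◅ ((E-sym G e , v∉C ∘ EC⇒VC ∘ EC-sym C) ◅ ε)

  module _ {y} (y∈C : VC C y) where

    private
      K : Graph n
      K = D- G C y
      reach? = star? (E G∖C) (E? G∖C) y

    ∈branch⁺ : ∀ {v} → v ∈ V G → Star (E G∖C) y v → v ≢ y → v ∈ V K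
    ∈branch⁺ {v} v∈V s v≢y = x∈p∩q⁺ (v∈D , x∈p∧x≢y⇒x∈p-y v∈D v≢y)
      where
      v∈D : v ∈ V (D G C y)
      v∈D = x∈p∩q⁺ (v∈V , ∈-comprehension⁺ reach? s)

    ∈branch⁻ : ∀ {v} → v ∈ V K → v ∈ V G × Star (E G∖C) y v × v ≢ y
    ∈branch⁻ v∈K with x∈p∩q⁻ (V (D G C y)) (V (D G C y) - y) v∈K
    ... | v∈D , v∈D-y with x∈p∩q⁻ (V G) (comprehension reach?) v∈D
    ... | v∈V , v~ = v∈V , ∈-comprehension⁻ reach? v~ , λ { refl → x∉p-x v∈D-y }

    -- By `cycle-separated`, the component of `y` meets `C` only in `y`, which the branch omits.
    branch∌C : ∀ {v} → v ∈ V K → ¬ VC C v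
    branch∌C v∈K v∈C with ∈branch⁻ v∈K
    ... | _ , s , v≢y = v≢y (cycle-separated y∈C v∈C s)

    branch-setting : Setting K none? 0
    branch-setting = bipartite K {c 0} λ (((e , ¬ec) , _) , _) → c-proper 0 (¬EC⇒cut 0 e ¬ec)

    private
      H R : Rel (Fin n) 0ℓ
      H = Outer G (vc? C)
      R = Outer K none?

      R⊆H : ∀ {u v} → R u v → H u v
      R⊆H (e@(((e′ , _) , _) , _) , _) = e′ , branch∌C (E⇒V K e) , branch∌C (E⇒V K (E-sym K e))

      H-closed : ∀ {u v} → H u v → u ∈ V K → v ∈ V K
      H-closed {u} {v} (e , u∉C , v∉C) u∈K with ∈branch⁻ u∈K
      ... | _ , s , _ = ∈branch⁺ (E⇒V G (E-sym G e)) (s ◅◅ ((e , u∉C ∘ EC⇒VC) ◅ ε)) λ { refl → v∉C y∈C }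

      H⇒R : ∀ {u v} → H u v → u ∈ V K → R u v
      H⇒R {u} {v} h@(e , u∉C , v∉C) u∈K = (((e , u∉C ∘ EC⇒VC) , in-component u∈K , in-component v∈K)
                                     , in-D-y u∈K , in-D-y v∈K) , id , id
        where
        v∈K : v ∈ V K
        v∈K = H-closed h u∈K
        in-component : ∀ {w} → w ∈ V K → w ∈ comprehension reach?
        in-component w∈K = ∈-comprehension⁺ reach? (proj₁ (proj₂ (∈branch⁻ w∈K)))
        in-D-y : ∀ {w} → w ∈ V K → w ∈ V (D G C y) - y
        in-D-y = proj₂ ∘ x∈p∩q⁻ (V (D G C y)) (V (D G C y) - y)

      -- No edge outside C leaves the branch, so matchings can be exchanged on it.
      module Swap {h r} (Hm : Maximum H h) (Rm : Maximum R r) where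

        private
          module Hm = Maximum Hm
          module Rm = Maximum Rm
          in? : Pred.Decidable (_∈ V K)
          in? = _∈? V K
          h-closed : ∀ {v} → v ∈ V K → h v ∈ V K
          h-closed = mate-closed Hm.mate (_∈ V K) H-closed
          r-closed : ∀ {v} → v ∈ V K → r v ∈ V K
          r-closed = mate-closed (mate-mono R⊆H Rm.mate) (_∈ V K) H-closed

          rh : Mate H (splice in? r h)
          rh = splice-mate in? (mate-mono R⊆H Rm.mate) Hm.mate r-closed h-closed

          hr : Mate R (splice in? h r)
          hr = mate-refine swapped λ {v} → edge v (in? v)
            where
            swapped : Mate H (splice in? h r)
            swapped = splice-mate in? Hm.mate (mate-mono R⊆H Rm.mate) h-closed r-closed
            edge : ∀ v → Dec (v ∈ V K) → splice in? h r v ≢ v → R v (splice in? h r v)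
            edge v (yes v∈K) ≢v = H⇒R (Mate.edge swapped ≢v) v∈K
            edge v (no v∉K)  ≢v = subst (R v) (sym eq) (Rm.edge λ rv≡v → ≢v (trans eq rv≡v))
              where
              eq : splice in? h r v ≡ r v
              eq = splice-out in? h r v∉K

        missable-R : ∀ {v} → v ∈ V K → h v ≡ v → Missable R v
        missable-R v∈K hv≡v = splice in? h r
          , maximum-≤ Rm hr (splice-≤ʳ in? (Hm.minimal _ rh))
          , trans (splice-in in? h r v∈K) hv≡v

        missable-H : ∀ {v} → v ∈ V K → r v ≡ v → Missable H v
        missable-H v∈K rv≡v = splice in? r h
          , maximum-≤ Hm rh (splice-≤ʳ in? (Rm.minimal _ hr))
          , trans (splice-in in? r h v∈K) rv≡v

    private
      free⇒D-free : ∀ {v} → Free G (vc? C) v → v ∈ V K → ¬ ¬ Free K none? v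
      free⇒D-free (_ , _ , h , Hm , hv≡v) v∈K k = ¬¬-maximum R λ (r , Rm) →
        k (v∈K , id , Swap.missable-R Hm Rm v∈K hv≡v)

      D-free⇒free : ∀ {v} → Free K none? v → ¬ ¬ Free G (vc? C) v
      D-free⇒free (v∈K , _ , r , Rm , rv≡v) k = ¬¬-maximum H λ (h , Hm) →
        k (proj₁ (∈branch⁻ v∈K) , branch∌C v∈K , Swap.missable-H Hm Rm v∈K rv≡v)

    free⇒D-core : ∀ {v} → Free G (vc? C) v → v ∈ V K → core K v
    free⇒D-core f v∈K = core-stable K λ k → free⇒D-free f v∈K (k ∘ Optimal.free⇒core branch-setting)

    free⇒D-ker : ∀ {v} → Free G (vc? C) v → v ∈ V K → ker K v
    free⇒D-ker f v∈K = ker-stable K λ k → free⇒D-free f v∈K (k ∘ Optimal.free⇒ker branch-setting)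

    D-core⇒free : ∀ {v} → core K v → ¬ ¬ Free G (vc? C) v
    D-core⇒free v∈ k = Optimal.core⇒free branch-setting v∈ λ f → D-free⇒free f k

    D-ker⇒free : ∀ {v} → ker K v → ¬ ¬ Free G (vc? C) v
    D-ker⇒free v∈ k = Optimal.ker⇒free branch-setting v∈ λ f → D-free⇒free f k

  -- A walk from `v` to the cycle determines the branch explicitly, so the union has a genuine
  -- index; only membership in `F` relies on stability under double negation.
  ⋃⁺ : Connected G → {F : Graph n → Pred (Fin n) 0ℓ} →
       (∀ {H v} → ¬ ¬ F H v → F H v) →
       (∀ {y} → VC C y → ∀ {v} → Free G (vc? C) v → v ∈ V (D- G C y) → F (D- G C y) v) →
       ∀ {v} → ¬ ¬ Free G (vc? C) v → ⋃D- G C F v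
  ⋃⁺ conn F-stable free⇒F {v} free
    with cycle-reached (conn (decidable-stable (v ∈? V G) λ v∉V → free (v∉V ∘ proj₁)) (VC⇒V (p∈VC 0))) (p∈VC 0)
  ... | y , y∈C , s = (y , y∈C) , F-stable λ k → free λ f@(v∈V , v∉C , _) →
        k (free⇒F y∈C f (∈branch⁺ y∈C v∈V s λ { refl → v∉C y∈C }))

theorem2p10 : (n : ℕ) (G : Graph n) (ab : AlmostBipartite G) → ¬ KőnigEgerváry G →
    let C = AlmostBipartite.C ab in
    ker G ≐ core G
    × (Connected G →
    ker G ≐ ⋃D- G C ker
    × ⋃D- G C ker ≐ ⋃D- G C core
    × ⋃D- G C core ≐ core G)
theorem2p10 n G ab ¬KE = (ker⊆core , core⊆ker) , λ conn →
  let ker⊆⋃ker   = λ {v} v∈ → Branches.⋃⁺ G ab conn {ker} (λ {K} → ker-stable K) free⇒D-ker {v} (ker⇒free v∈)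
      core⊆⋃core = λ {v} v∈ → Branches.⋃⁺ G ab conn {core} (λ {K} → core-stable K) free⇒D-core {v} (core⇒free v∈)
  in (ker⊆⋃ker , ⋃ker⊆ker)
   -- The equality of the two unions passes through the equality of ker and core of `G`.
   , ((λ v∈ → core⊆⋃core (ker⊆core (⋃ker⊆ker v∈))) , λ v∈ → ker⊆⋃ker (core⊆ker (⋃core⊆core v∈)))
   , (⋃core⊆core , core⊆⋃core)
  where
  open AlmostBipartite ab using (C)
  core⇒free : ∀ {v} → core G v → ¬ ¬ Free G (vc? C) v
  core⇒free = NonKE.core⇒free G ab ¬KE
  ker⇒free : ∀ {v} → ker G v → ¬ ¬ Free G (vc? C) v
  ker⇒free = NonKE.ker⇒free G ab ¬KE
  free⇒D-core : ∀ {y} → VC C y → ∀ {v} → Free G (vc? C) v → v ∈ V (D- G C y) → core (D- G C y) v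
  free⇒D-core = Branches.free⇒D-core G ab
  free⇒D-ker : ∀ {y} → VC C y → ∀ {v} → Free G (vc? C) v → v ∈ V (D- G C y) → ker (D- G C y) v
  free⇒D-ker = Branches.free⇒D-ker G ab
  ker⊆core : ∀ {v} → ker G v → core G v
  ker⊆core v∈ = core-stable G λ k → ker⇒free v∈ (k ∘ NonKE.free⇒core G ab ¬KE)
  core⊆ker : ∀ {v} → core G v → ker G v
  core⊆ker v∈ = ker-stable G λ k → core⇒free v∈ (k ∘ NonKE.free⇒ker G ab ¬KE)
  ⋃ker⊆ker : ∀ {v} → ⋃D- G C ker v → ker G v
  ⋃ker⊆ker ((_ , y∈C) , v∈) = ker-stable G λ k →
    Branches.D-ker⇒free G ab y∈C v∈ (k ∘ NonKE.free⇒ker G ab ¬KE)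
  ⋃core⊆core : ∀ {v} → ⋃D- G C core v → core G v
  ⋃core⊆core ((_ , y∈C) , v∈) = core-stable G λ k →
    Branches.D-core⇒free G ab y∈C v∈ (k ∘ NonKE.free⇒core G ab ¬KE)
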